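{- For all integers $n>k\ge 1$, the quasisymmetric functions $$\mathcal{Q}(G_{n,k}):=\sum_{p\in G_{n,k}}\mathcal{F}_{\operatorname{Des}(p)}\qquad\text{and}\qquad \mathcal{Q}(T_{n,k}):=\sum_{p\in T_{n,k}}\mathcal{F}_{\operatorname{Des}(p)}$$ are symmetric and Schur-positive.
   Context: $K_n$ is the complete graph on vertex set $\{1,\dots,n\}$; $\overrightarrow{K}_n$ is the transitive tournament with vertex set $\{1,\dots,n\}$ and directed edges $(i,j)$, $i<j$. $G_{n,k}$ is the set of Gallai $k$-partitions of $K_n$: unordered partitions of the edge set into $k$ nonempty blocks such that every cycle contains at least two edges in the same block. $T_{n,k}$ is the set of transitive $k$-partitions of $\overrightarrow{K}_n$: unordered partitions of the edge set into $k$ nonempty blocks such that every cycle of the underlying undirected graph contains two edges in the same block that have opposite orientations with respect to a traversal of the cycle. The descent set of such a partition $p$ is $\operatorname{Des}(p):=\{i\in\{1,\dots,n-1\}: \text{the edge }(i,i+1)\text{ forms a singleton block in }p\}$. For $J\subseteq\{1,\dots,n-1\}$, the fundamental quasisymmetric function is $\mathcal{F}_J(\mathbf{x}):=\sum x_{i_1}x_{i_2}\cdots x_{i_n}$, summed over $i_1\le i_2\le\dots\le i_n$ with $i_j<i_{j+1}$ whenever $j\in J$. A symmetric function is Schur-positive if all coefficients in its expansion in the Schur basis are nonnegative. -}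

module Defs where

open import Data.Fin using (Fin; zero; suc; inject₁; _<_; _≤_; _>_; _<?_; _≤?_)
open import Data.Fin.Properties using (_≟_; all?; injective⇒≤)
open import Data.Fin.Subset using (Subset; _∈_)
open import Data.Fin.Subset.Properties using (_∈?_)
open import Data.Integer using (ℤ; +_; 0ℤ; _+_; _*_) renaming (_≤_ to _≤ℤ_)
open import Data.List using (List; []; _∷_; [_]; _∷ʳ_; map; concat; concatMap; zip; filter;
  foldr; length; allFin; cartesianProduct; cartesianProductWith; tabulate; lookup; upTo)
import Data.List.Membership.Propositional as L
open import Data.List.Membership.Propositional.Properties
  using (∈-allFin; ∈-cartesianProductWith⁺; ∈-concatMap⁺; ∈-upTo⁺; ∈-lookup)
import Data.List.Membership.DecPropositional as DecMembership
open import Data.List.Properties using () renaming (≡-dec to ≡-decList)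
open import Data.List.Relation.Binary.Permutation.Propositional using (_↭_)
open import Data.List.Relation.Binary.Prefix.Heterogeneous using (Prefix)
open import Data.List.Relation.Binary.Prefix.Heterogeneous.Properties using (prefix?)
open import Data.List.Relation.Unary.All as All using (All; []; _∷_)
open import Data.List.Relation.Unary.Any as Any using (Any; any?)
open import Data.List.Relation.Unary.AllPairs using ([]; _∷_)
open import Data.List.Relation.Unary.Linked using (Linked; linked?)
open import Data.List.Relation.Unary.Unique.Propositional using (Unique)
import Data.List.Relation.Unary.Unique.DecPropositional as DecUnique
open import Data.Nat using (ℕ; zero; suc; pred; s≤s)
import Data.Nat as ℕ
open import Data.Nat.ListAction using (sum)
import Data.Nat.Properties as ℕ
open import Data.Product using (∃; Σ; _×_; _,_; proj₁; proj₂)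
open import Data.Product.Properties using () renaming (≡-dec to ≡-dec×)
open import Data.Vec as Vec using (Vec; toList)
open import Function using (_∘_; _$_; Injective)
open import Relation.Binary using (DecidableEquality)
open import Relation.Binary.PropositionalEquality using (_≡_; _≢_; refl; sym; cong)
open import Relation.Nullary using (Dec; yes; no; does; ¬?; contradiction)
open import Relation.Nullary.Decidable using (map′; _×-dec_; _→-dec_)
open import Relation.Unary using (Decidable)

private
  variable
    A : Set
    n m : ℕ

words : List A → (n : ℕ) → List (List A)
words as zero    = [ [] ]
words as (suc n) = cartesianProductWith _∷_ as (words as n)

∑ : List A → (A → ℤ) → ℤ
∑ as f = foldr _+_ 0ℤ (map f as)

------------------------------------------------------------------------
-- Edges of K_n and partitions of the edge set

-- The edge {i , j} of K_n, i < j, is the pair (i , j); the same pair is the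
-- directed edge of the transitive tournament.  Vertex v + 1 is v : Fin n.

Edge : ℕ → Set
Edge n = Fin n × Fin n

_≟ᴱ_ : DecidableEquality (Edge n)
_≟ᴱ_ = ≡-dec× _≟_ _≟_

edges : (n : ℕ) → List (Edge n)
edges n = filter (λ (i , j) → i <? j) (cartesianProduct (allFin n) (allFin n))

Blocks : ℕ → Set
Blocks n = List (List (Edge n))

-- The set partitions of a list of distinct elements, each listed exactly once
-- (with its blocks, and the elements within a block, in one fixed order):
-- the first element either is a block by itself or joins a block of a
-- partition of the rest.

joins : A → List (List A) → List (List (List A))
joins a []      = []
joins a (B ∷ p) = ((a ∷ B) ∷ p) ∷ map (B ∷_) (joins a p)

setPartitions : List A → List (List (List A))
setPartitions []       = [ [] ]
setPartitions (a ∷ as) = concatMap (λ p → ([ a ] ∷ p) ∷ joins a p) (setPartitions as)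

SameBlock : Blocks n → Edge n → Edge n → Set
SameBlock p e f = Any (λ B → e L.∈ B × f L.∈ B) p

sameBlock? : (p : Blocks n) (e f : Edge n) → Dec (SameBlock p e f)
sameBlock? p e f = any? (λ B → (e ∈ᴱ? B) ×-dec (f ∈ᴱ? B)) p
  where open DecMembership _≟ᴱ_ renaming (_∈?_ to _∈ᴱ?_)

------------------------------------------------------------------------
-- Cycles of K_n, given by a traversal

IsCycle : List (Fin n) → Set
IsCycle vs = 3 ℕ.≤ length vs × Unique vs

isCycle? : Decidable (IsCycle {n})
isCycle? vs = (3 ℕ.≤? length vs) ×-dec DecUnique.unique? _≟_ vs

-- The steps (v₁ , v₂), …, (vᵣ₋₁ , vᵣ), (vᵣ , v₁) of the traversal.

steps : List (Fin n) → List (Fin n × Fin n)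
steps []       = []
steps (v ∷ vs) = zip (v ∷ vs) (vs ∷ʳ v)

edgeOf : Fin n × Fin n → Edge n
edgeOf (a , b) with a <? b
... | yes _ = a , b
... | no  _ = b , a

IsGallai : Blocks n → Set
IsGallai p = ∀ vs → IsCycle vs →
  Any (λ s → Any (λ t → edgeOf s ≢ edgeOf t × SameBlock p (edgeOf s) (edgeOf t)) (steps vs))
      (steps vs)

-- The step s follows the direction of its edge and the step t opposes it.

IsTransitive : Blocks n → Set
IsTransitive p = ∀ vs → IsCycle vs →
  Any (λ s → Any (λ t → (proj₁ s < proj₂ s) × (proj₂ t < proj₁ t) ×
                        SameBlock p (edgeOf s) (edgeOf t)) (steps vs))
      (steps vs)

-- Both conditions are decidable, as a list of distinct elements of Fin n has
-- length at most n.

private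
  lookup-injective : {as : List A} → Unique as → Injective _≡_ _≡_ (lookup as)
  lookup-injective (_ ∷ _)    {zero}  {zero}  _  = refl
  lookup-injective (a∉ ∷ _)   {zero}  {suc j} eq = contradiction eq (All.lookup a∉ (∈-lookup j))
  lookup-injective (a∉ ∷ _)   {suc i} {zero}  eq = contradiction (sym eq) (All.lookup a∉ (∈-lookup i))
  lookup-injective (_ ∷ uniq) {suc i} {suc j} eq = cong suc (lookup-injective uniq eq)

  ∈-words : (vs : List (Fin n)) → vs L.∈ words (allFin n) (length vs)
  ∈-words []       = Any.here refl
  ∈-words (v ∷ vs) = ∈-cartesianProductWith⁺ _∷_ (∈-allFin v) (∈-words vs)

allCycles? : {P : List (Fin n) → Set} → Decidable P → Dec (∀ vs → IsCycle vs → P vs)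
allCycles? {n} {P} P? =
  map′ (λ ps vs c → All.lookup ps (complete vs c) c) (λ f → All.universal f candidates)
       (All.all? (λ vs → isCycle? vs →-dec P? vs) candidates)
  where
  candidates : List (List (Fin n))
  candidates = concatMap (words (allFin n)) (upTo (suc n))

  complete : ∀ vs → IsCycle vs → vs L.∈ candidates
  complete vs (_ , uniq) = ∈-concatMap⁺ (words (allFin n)) $
    Any.map (λ { refl → ∈-words vs }) (∈-upTo⁺ (s≤s (injective⇒≤ (lookup-injective uniq))))

isGallai? : Decidable (IsGallai {n})
isGallai? p = allCycles? λ vs →
  any? (λ s → any? (λ t → ¬? (edgeOf s ≟ᴱ edgeOf t) ×-dec sameBlock? p (edgeOf s) (edgeOf t))
                   (steps vs)) (steps vs)

isTransitive? : Decidable (IsTransitive {n})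
isTransitive? p = allCycles? λ vs →
  any? (λ s → any? (λ t → (proj₁ s <? proj₂ s) ×-dec (proj₂ t <? proj₁ t) ×-dec
                          sameBlock? p (edgeOf s) (edgeOf t)) (steps vs)) (steps vs)

kPartitions : (n k : ℕ) → List (Blocks n)
kPartitions n k = filter (λ p → length p ℕ.≟ k) (setPartitions (edges n))

G : (n k : ℕ) → List (Blocks n)
G n k = filter isGallai? (kPartitions n k)

T : (n k : ℕ) → List (Blocks n)
T n k = filter isTransitive? (kPartitions n k)

-- The element j of {1, …, n-1} is j - 1 : Fin (pred n), and at j, next j are
-- the positions j, j + 1 in {1, …, n}.

at next : Fin (pred n) → Fin n
at   {suc n} j = inject₁ j
next {suc n} j = suc j

Des : Blocks n → Subset (pred n)
Des p = Vec.tabulate λ j → does ([ at j , next j ] ∈ᴮ? p)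
  where open DecMembership (≡-decList _≟ᴱ_) renaming (_∈?_ to _∈ᴮ?_)

------------------------------------------------------------------------
-- Formal power series in x₁, x₂, …

-- A list e₁, …, eₘ stands for the monomial x₁^e₁ ⋯ xₘ^eₘ, so that trailing
-- zeros are immaterial; a series is given by its coefficients.

Monomial : Set
Monomial = List ℕ

Series : Set
Series = Monomial → ℤ

content : List (Fin m) → Monomial
content w = tabulate λ v → length (filter (v ≟_) w)

_≟ᴹ_ : DecidableEquality Monomial
_≟ᴹ_ = ≡-decList ℕ._≟_

-- `stable` and `bounded` say that the coefficients are those of a power series
-- of bounded degree; `invariant` says that it is fixed by permuting variables.

record IsSymmetric (f : Series) : Set where
  field
    stable    : ∀ e → f (e ∷ʳ 0) ≡ f e
    bounded   : ∃ λ d → ∀ e → d ℕ.< sum e → f e ≡ 0ℤ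
    invariant : ∀ {e e′} → e ↭ e′ → f e ≡ f e′

-- The index sequences i₁ ≤ … ≤ iₙ in the definition of the fundamental
-- quasisymmetric function.  A sequence contributing to the coefficient of
-- x₁^e₁ ⋯ xₘ^eₘ has all its entries in {1, …, m}.

vectors : List A → (n : ℕ) → List (Vec A n)
vectors as zero    = [ Vec.[] ]
vectors as (suc n) = cartesianProductWith Vec._∷_ as (vectors as n)

Admissible : Subset (pred n) → Vec (Fin m) n → Set
Admissible J i = ∀ j →
  (Vec.lookup i (at j) ≤ Vec.lookup i (next j)) ×
  (j ∈ J → Vec.lookup i (at j) < Vec.lookup i (next j))

admissible? : (J : Subset (pred n)) → Decidable (Admissible {n} {m} J)
admissible? J i = all? λ j →
  (Vec.lookup i (at j) ≤? Vec.lookup i (next j)) ×-dec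
  ((j ∈? J) →-dec (Vec.lookup i (at j) <? Vec.lookup i (next j)))

𝓕 : (n : ℕ) → Subset (pred n) → Series
𝓕 n J e = + length
  (filter (λ i → admissible? J i ×-dec (content (toList i) ≟ᴹ e))
          (vectors (allFin (length e)) n))

𝓠 : List (Blocks n) → Series
𝓠 {n} ps e = ∑ ps λ p → 𝓕 n (Des p) e

------------------------------------------------------------------------
-- Schur functions

record Partition : Set where
  field
    parts      : List ℕ
    positive   : All (0 ℕ.<_) parts
    decreasing : Linked ℕ._≥_ parts

open Partition public

-- A tableau is the list of its rows, from the top (English notation).

Tableau : ℕ → Set
Tableau m = List (List (Fin m))

fillings : (m : ℕ) → List ℕ → List (Tableau m)
fillings m []       = [ [] ]
fillings m (r ∷ rs) = cartesianProductWith _∷_ (words (allFin m) r) (fillings m rs)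

-- Prefix _>_ lower upper compares the two rows column by column.

IsSemistandard : Tableau m → Set
IsSemistandard t = All (Linked _≤_) t × Linked (λ upper lower → Prefix _>_ lower upper) t

isSemistandard? : Decidable (IsSemistandard {m})
isSemistandard? t =
  All.all? (linked? _≤?_) t ×-dec
  linked? (λ upper lower → prefix? (λ a b → b <? a) lower upper) t

schur : Partition → Series
schur shape e = + length
  (filter (λ t → isSemistandard? t ×-dec (content (concat t) ≟ᴹ e))
          (fillings (length e) (parts shape)))

record SchurExpansion (f : Series) : Set where
  field
    terms     : List (ℤ × Partition)
    distinct  : Unique (map (parts ∘ proj₂) terms)
    expansion : ∀ e → f e ≡ ∑ terms λ (c , shape) → c * schur shape e

SchurPositive : Series → Set
SchurPositive f = Σ (SchurExpansion f) λ E → All (λ (c , _) → 0ℤ ≤ℤ c) (SchurExpansion.terms E)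

{-# OPTIONS --safe #-}
module Submission where

-- If the edge {i , i+1} is a singleton block of a Gallai or transitive
-- partition, then i and i+1 are twins: their edges to any third vertex share a
-- block.  Hence no two descents are adjacent, and a pair of twins can be moved
-- past a neighbouring vertex.  So the number of partitions p with J ⊆ Des p is,
-- for J without adjacent elements, a function ν of |J| alone.
--
-- By inclusion and exclusion the coefficient of x^e in 𝓠 is (U e₁ ∘ ⋯ ∘ U eₘ) ν 0,
-- where U a is the a-th Chebyshev polynomial in the shift operator.  These
-- operators commute, which gives symmetry.  The Clebsch-Gordan rule for U a ∘ U b
-- is also the recursion for semistandard tableaux with two rows, so that
-- 𝓠 = Σ_b c_b s_(n-b,b) with c_b = U (n-2b) ν b, the number of p whose descents are
-- exactly 1, 3, …, 2b-1.

open import Defs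
open import Data.Nat using (ℕ; _≤_; _<_)
open import Data.Product using (_×_)

open import Data.Bool using (Bool; true; false; not; _∧_) renaming (T to IsTrue)
open import Data.Bool.Properties using () renaming (_≟_ to _≟ᵇ_)
open import Data.Empty using (⊥)
open import Data.Fin using (Fin; zero; suc; toℕ; inject₁; fromℕ<)
  renaming (_≤_ to _≤ᶠ_; _<_ to _<ᶠ_; _>_ to _>ᶠ_; _<?_ to _<?ᶠ_)
import Data.Fin.Properties as Fin
open import Data.Fin.Properties using (_≟_)
open import Data.Fin.Subset using (Subset)
open import Data.Integer using (ℤ; +_; 0ℤ; 1ℤ; _+_; _-_; _*_)
import Data.Integer as ℤ
import Data.Integer.Properties as ℤ
open import Data.Integer.Tactic.RingSolver using (solve-∀)
open import Data.List using (List; []; _∷_; [_]; _∷ʳ_; _++_; map; concat; concatMap; zip; filter;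
  length; allFin; applyUpTo; replicate; drop; cartesianProduct)
open import Data.List.Membership.Propositional using (_∈_; _∉_; find; lose)
open import Data.List.Membership.Propositional.Properties using (∈-∃++; ∈-++⁻; ∈-++⁺ˡ; ∈-++⁺ʳ;
  ∈-map⁺; ∈-map⁻; ∈-filter⁺; ∈-filter⁻; ∈-allFin; ∈-cartesianProduct⁺; ∈-cartesianProductWith⁺;
  ∈-cartesianProductWith⁻; ∈-concatMap⁺; ∈-concatMap⁻; ∈-upTo⁺)
import Data.List.Membership.DecPropositional as DecMembership
open import Data.List.Properties using (∷-injective; ∷-injectiveˡ; ∷-injectiveʳ; ∷ʳ-++; ++-identityʳ;
  ++-cancelˡ; length-map; length-++; length-replicate; length-upTo; map-injective; map-applyUpTo;
  filter-++; tabulate-cong) renaming (≡-dec to ≡-decList)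
open import Data.List.Relation.Binary.Permutation.Propositional as Perm using (_↭_; ↭-sym)
open import Data.List.Relation.Binary.Permutation.Propositional.Properties using (shift; ∈-resp-↭; ++⁺ˡ)
import Data.List.Relation.Binary.Permutation.Setoid.Properties as Setoid↭
open import Data.List.Relation.Binary.Prefix.Heterogeneous using (Prefix; []; _∷_)
import Data.List.Relation.Binary.Prefix.Heterogeneous as Prefix
import Data.List.Relation.Binary.Prefix.Heterogeneous.Properties as Prefix
open import Data.List.Relation.Binary.Subset.Propositional using (_⊆_)
open import Data.List.Relation.Unary.All as All using (All; []; _∷_)
import Data.List.Relation.Unary.All.Properties as All
open import Data.List.Relation.Unary.AllPairs using ([]; _∷_)
open import Data.List.Relation.Unary.Any as Any using (Any; here; there)
open import Data.List.Relation.Unary.Linked as Linked using (Linked; []; [-]; _∷_)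
import Data.List.Relation.Unary.Linked.Properties as Linked
open import Data.List.Relation.Unary.Unique.Propositional using (Unique)
import Data.List.Relation.Unary.Unique.Propositional.Properties as Unique
open import Data.Nat using (zero; suc; _∸_; z≤n; s≤s)
import Data.Nat as ℕ
import Data.Nat.Properties as ℕ
open import Data.Nat.ListAction using (sum)
open import Data.Nat.ListAction.Properties using (sum-↭; sum-++)
open import Data.Product using (∃; ∃₂; _,_; proj₁; proj₂)
open import Data.Product.Properties using (,-injective; ,-injectiveˡ; ,-injectiveʳ)
open import Data.Sum using (_⊎_; inj₁; inj₂)
open import Data.Unit using (⊤; tt)
open import Data.Vec as Vec using (Vec; toList)
import Data.Vec.Properties as Vec
open import Function using (_∘_; case_of_)
open import Relation.Binary using (DecidableEquality; tri<; tri≈; tri>)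
open import Relation.Binary.PropositionalEquality using (_≡_; _≢_; _≗_; refl; sym; trans; cong; cong₂;
  subst; subst₂; ≢-sym; setoid; module ≡-Reasoning)
open import Relation.Nullary using (¬_; does; yes; no; contradiction; _×-dec_)
open import Relation.Nullary.Decidable using (dec-true)
open import Relation.Unary using (Decidable)
open import Algebra.Properties.CommutativeSemigroup ℕ.+-commutativeSemigroup
  using () renaming (interchange to ℕ-interchange)
open import Algebra.Properties.CommutativeSemigroup ℤ.+-commutativeSemigroup
  using () renaming (interchange to ℤ-interchange)

-- Both conditions on cycles reduce to conditions on triangles: a chord cuts a long cycle into a
-- triangle and a shorter cycle, and two conflicts that use the chord in its two directions combine
-- into one without it. For a triangle on a < b < c the two kinds of partition differ only in
-- whether ab and bc may be the repeated pair, so one argument with a parameter `Allow` serves both.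
-- Permuting the vertices is no way to move a pair of twins, as it may destroy the transitive
-- condition, which depends on their order. Instead one of the twins is turned into a copy of its
-- neighbour on the other side, and the remaining vertices keep their edges and their order. Nothing
-- is lost, because the edges of a twin can be recovered from those of its partner. The new
-- partition is a pullback along a map of edges, so it is described by its relation of being in the
-- same block and not by its list of blocks.

private
  variable
    n m : ℕ

-- Chebyshev polynomials of the second kind in the shift operator t: the
-- coefficient of (-t)^j in U a is the number of j-matchings of a path with a
-- vertices.
U : ℕ → (ℕ → ℤ) → ℕ → ℤ
U 0             f d = f d
U 1             f d = f d
U (suc (suc a)) f d = U (suc a) f d - U a f (suc d)

U-cong : ∀ a {f g : ℕ → ℤ} → f ≗ g → U a f ≗ U a g
U-cong 0             f≗g d = f≗g d
U-cong 1             f≗g d = f≗g d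
U-cong (suc (suc a)) f≗g d = cong₂ _-_ (U-cong (suc a) f≗g d) (U-cong a f≗g (suc d))

U-shift : ∀ a (f : ℕ → ℤ) d → U a (f ∘ suc) d ≡ U a f (suc d)
U-shift 0             f d = refl
U-shift 1             f d = refl
U-shift (suc (suc a)) f d = cong₂ _-_ (U-shift (suc a) f d) (U-shift a f (suc d))

private
  rearrange₁ : ∀ w x y z → (w - x) - (y - z) ≡ (w - y) - (x - z)
  rearrange₁ = solve-∀

  rearrange₂ : ∀ x y → x ≡ (x - y) + y
  rearrange₂ = solve-∀

  rearrange₃ : ∀ x y z → x - z ≡ (((x - y) - z) + y)
  rearrange₃ = solve-∀

  rearrange₄ : ∀ w x y z → (w + x) - (y + z) ≡ (w - y) + (x - z)
  rearrange₄ = solve-∀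

U-sub : ∀ a (f g : ℕ → ℤ) d → U a (λ c → f c - g c) d ≡ U a f d - U a g d
U-sub 0             f g d = refl
U-sub 1             f g d = refl
U-sub (suc (suc a)) f g d = trans
  (cong₂ _-_ (U-sub (suc a) f g d) (U-sub a f g (suc d)))
  (rearrange₁ (U (suc a) f d) (U (suc a) g d) (U a f (suc d)) (U a g (suc d)))

-- `U b` is linear and commutes with the shift, so it passes through the recursion that defines
-- `U a`.
U-comm : ∀ a b f → U a (U b f) ≗ U b (U a f)
U-comm 0             b f d = U-cong b (λ _ → refl) d
U-comm 1             b f d = U-cong b (λ _ → refl) d
U-comm (suc (suc a)) b f d = begin
  U (suc a) (U b f) d - U a (U b f) (suc d)    ≡⟨ cong₂ _-_ (U-comm (suc a) b f d) (U-comm a b f (suc d)) ⟩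
  U b (U (suc a) f) d - U b (U a f) (suc d)    ≡⟨ cong (U b (U (suc a) f) d -_) (U-shift b (U a f) d) ⟨
  U b (U (suc a) f) d - U b (U a f ∘ suc) d    ≡⟨ U-sub b (U (suc a) f) (U a f ∘ suc) d ⟨
  U b (U (suc (suc a)) f) d                    ∎
  where open ≡-Reasoning

-- Cut a path with a + b + 2 vertices after the vertex a + 1. A matching either omits the edge at
-- the cut, or contains it and leaves paths with a and b vertices.
clebsch-gordan : ∀ a b f d →
  U (suc a) (U (suc b) f) d ≡ U (suc (suc (a ℕ.+ b))) f d + U a (U b f) (suc d)
clebsch-gordan 0             b f d = rearrange₂ (U (suc b) f d) (U b f (suc d))
clebsch-gordan 1             b f d =
  rearrange₃ (U (suc b) f d) (U b f (suc d)) (U (suc b) f (suc d))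
clebsch-gordan (suc (suc a)) b f d = trans
  (cong₂ _-_ (clebsch-gordan (suc a) b f d) (clebsch-gordan a b f (suc d)))
  (rearrange₄ (U (suc (suc (suc (a ℕ.+ b)))) f d) (U (suc a) (U b f) (suc d))
              (U (suc (suc (a ℕ.+ b))) f (suc d)) (U a (U b f) (suc (suc d))))

U* : List ℕ → (ℕ → ℤ) → ℕ → ℤ
U* []      f = f
U* (a ∷ e) f = U a (U* e f)

-- Finite sums and counting by injections

∑< : ℕ → (ℕ → ℤ) → ℤ
∑< zero    f = 0ℤ
∑< (suc Y) f = f 0 + ∑< Y (f ∘ suc)

∑<-cong : ∀ Y {f g : ℕ → ℤ} → (∀ y → y < Y → f y ≡ g y) → ∑< Y f ≡ ∑< Y g
∑<-cong zero    f≗g = refl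
∑<-cong (suc Y) f≗g = cong₂ _+_ (f≗g 0 (s≤s z≤n)) (∑<-cong Y λ y y<Y → f≗g (suc y) (s≤s y<Y))

∑<-zero : ∀ Y {f : ℕ → ℤ} → (∀ y → f y ≡ 0ℤ) → ∑< Y f ≡ 0ℤ
∑<-zero zero    f≗0 = refl
∑<-zero (suc Y) f≗0 = cong₂ _+_ (f≗0 0) (∑<-zero Y (f≗0 ∘ suc))

∑<-+ : ∀ Y (f g : ℕ → ℤ) → ∑< Y (λ y → f y + g y) ≡ ∑< Y f + ∑< Y g
∑<-+ zero    f g = refl
∑<-+ (suc Y) f g = trans (cong (_+_ (f 0 + g 0)) (∑<-+ Y (f ∘ suc) (g ∘ suc)))
  (ℤ-interchange (f 0) (g 0) (∑< Y (f ∘ suc)) (∑< Y (g ∘ suc)))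

∑-applyUpTo : ∀ {A : Set} (t : ℕ → A) F Y → ∑ (applyUpTo t Y) F ≡ ∑< Y (F ∘ t)
∑-applyUpTo t F zero    = refl
∑-applyUpTo t F (suc Y) = cong (_+_ (F (t 0))) (∑-applyUpTo (t ∘ suc) F Y)

∑-cong : ∀ {A : Set} (as : List A) {F F′ : A → ℤ} → (∀ {a} → a ∈ as → F a ≡ F′ a) →
         ∑ as F ≡ ∑ as F′
∑-cong []       F≗F′ = refl
∑-cong (a ∷ as) F≗F′ = cong₂ _+_ (F≗F′ (here refl)) (∑-cong as (F≗F′ ∘ there))

∑-+ : ∀ {A : Set} (as : List A) (F F′ : A → ℤ) → ∑ as (λ a → F a + F′ a) ≡ ∑ as F + ∑ as F′
∑-+ []       F F′ = refl
∑-+ (a ∷ as) F F′ = trans (cong (_+_ (F a + F′ a)) (∑-+ as F F′))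
  (ℤ-interchange (F a) (F′ a) (∑ as F) (∑ as F′))

∑-zero : ∀ {A : Set} (as : List A) {F : A → ℤ} → (∀ a → F a ≡ 0ℤ) → ∑ as F ≡ 0ℤ
∑-zero []       F≗0 = refl
∑-zero (a ∷ as) F≗0 = cong₂ _+_ (F≗0 a) (∑-zero as F≗0)

unique-⊆-length : ∀ {A : Set} {xs ys : List A} → Unique xs → xs ⊆ ys → length xs ≤ length ys
unique-⊆-length {xs = []}     _            _     = z≤n
unique-⊆-length {xs = x ∷ xs} (x∉xs ∷ xs!) xs⊆ys with ∈-∃++ (xs⊆ys (here refl))
... | ps , qs , refl = begin
  suc (length xs)                 ≤⟨ s≤s (unique-⊆-length xs! avoid) ⟩
  suc (length (ps ++ qs))         ≡⟨ cong suc (length-++ ps) ⟩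
  suc (length ps ℕ.+ length qs)   ≡⟨ ℕ.+-suc (length ps) (length qs) ⟨
  length ps ℕ.+ suc (length qs)   ≡⟨ length-++ ps ⟨
  length (ps ++ x ∷ qs)           ∎
  where
  open ℕ.≤-Reasoning
  avoid : xs ⊆ ps ++ qs
  avoid z∈xs with ∈-++⁻ ps (xs⊆ys (there z∈xs))
  ... | inj₁ z∈ps         = ∈-++⁺ˡ z∈ps
  ... | inj₂ (here refl)  = contradiction refl (All.lookup x∉xs z∈xs)
  ... | inj₂ (there z∈qs) = ∈-++⁺ʳ ps z∈qs

map-unique : ∀ {A B : Set} (f : A → B) {xs} → (∀ {x y} → x ∈ xs → y ∈ xs → f x ≡ f y → x ≡ y) →
             Unique xs → Unique (map f xs)
map-unique f {[]}     inj []          = []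
map-unique f {x ∷ xs} inj (x∉ ∷ xs!) =
  All.tabulate (λ fy∈ fx≡ → case ∈-map⁻ f fy∈ of λ { (y , y∈ , refl) →
    All.lookup x∉ y∈ (inj (here refl) (there y∈) fx≡) })
  ∷ map-unique f (λ x∈ y∈ → inj (there x∈) (there y∈)) xs!

length-injection : ∀ {A B : Set} (f : A → B) {xs ys} →
  (∀ {x y} → x ∈ xs → y ∈ xs → f x ≡ f y → x ≡ y) → Unique xs →
  (∀ {x} → x ∈ xs → f x ∈ ys) → length xs ≤ length ys
length-injection f {xs} inj xs! into = subst (_≤ _) (length-map f xs)
  (unique-⊆-length (map-unique f inj xs!) λ fx∈ → case ∈-map⁻ f fx∈ of λ { (x , x∈ , refl) → into x∈ })

length-bijection : ∀ {A B : Set} (f : A → B) {xs ys} →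
  (∀ {x y} → x ∈ xs → y ∈ xs → f x ≡ f y → x ≡ y) → Unique xs → Unique ys →
  (∀ {x} → x ∈ xs → f x ∈ ys) → (∀ {y} → y ∈ ys → ∃ λ x → x ∈ xs × y ≡ f x) →
  length xs ≡ length ys
length-bijection f {xs} inj xs! ys! into onto = ℕ.≤-antisym
  (length-injection f inj xs! into)
  (subst (_ ≤_) (length-map f xs) (unique-⊆-length ys! λ y∈ →
    case onto y∈ of λ { (x , x∈ , refl) → ∈-map⁺ f x∈ }))

-- Sorted words over a finite alphabet

Row : ℕ → Set
Row m = List (Fin m)

Sorted : Row m → Set
Sorted = Linked _≤ᶠ_

-- Every sorted row over `suc m` letters has this form with `w` sorted. Inductions on the alphabet
-- delete the smallest letter in this way, which removes the head of the monomial.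
zerosThen : ℕ → Row m → Row (suc m)
zerosThen a w = replicate a zero ++ map suc w

suc-sorted : {w : Row m} → Sorted w → Sorted (map suc w)
suc-sorted = Linked.map⁺ ∘ Linked.map s≤s

suc-sorted⁻ : {w : Row m} → Sorted (map suc w) → Sorted w
suc-sorted⁻ = Linked.map ℕ.≤-pred ∘ Linked.map⁻

zero∷-sorted : {w : Row (suc m)} → Sorted w → Sorted (zero ∷ w)
zero∷-sorted {w = []}    _  = [-]
zero∷-sorted {w = _ ∷ _} w↗ = z≤n ∷ w↗

zerosThen-sorted : ∀ a {w : Row m} → Sorted w → Sorted (zerosThen a w)
zerosThen-sorted zero    w↗ = suc-sorted w↗
zerosThen-sorted (suc a) w↗ = zero∷-sorted (zerosThen-sorted a w↗)

suc∷-sorted : ∀ {v} {w : Row (suc m)} → Sorted (suc v ∷ w) → ∃ λ w′ → suc v ∷ w ≡ map suc w′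
suc∷-sorted {v = v} {[]}        _         = [ v ] , refl
suc∷-sorted {v = v} {suc u ∷ w} (_ ∷ w↗)  with w′ , eq ← suc∷-sorted w↗ = v ∷ w′ , cong (suc v ∷_) eq
suc∷-sorted {v = v} {zero ∷ w}  (() ∷ _)

split-zeros : {w : Row (suc m)} → Sorted w → ∃₂ λ a w′ → w ≡ zerosThen a w′ × Sorted w′
split-zeros {w = []}        _  = 0 , [] , refl , []
split-zeros {w = zero ∷ w}  w↗ with split-zeros (Linked.tail w↗)
... | a , w′ , refl , w′↗ = suc a , w′ , refl , w′↗
split-zeros {w = suc v ∷ w} w↗ with w′ , eq ← suc∷-sorted w↗ =
  0 , w′ , eq , suc-sorted⁻ (subst Sorted eq w↗)

occurrences : Fin m → Row m → ℕ
occurrences v w = length (filter (v ≟_) w)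

occurrences-++ : ∀ (v : Fin m) w w′ →
  occurrences v (w ++ w′) ≡ occurrences v w ℕ.+ occurrences v w′
occurrences-++ v w w′ = trans (cong length (filter-++ (v ≟_) w w′)) (length-++ (filter (v ≟_) w))

occurrences-zero : ∀ a (w : Row m) → occurrences zero (zerosThen a w) ≡ a
occurrences-zero (suc a) w       = cong suc (occurrences-zero a w)
occurrences-zero zero    []      = refl
occurrences-zero zero    (_ ∷ w) = occurrences-zero zero w

occurrences-suc : ∀ a (v : Fin m) w → occurrences (suc v) (zerosThen a w) ≡ occurrences v w
occurrences-suc (suc a) v w       = occurrences-suc a v w
occurrences-suc zero    v []      = refl
occurrences-suc zero    v (u ∷ w) with v ≟ u
... | yes _ = cong suc (occurrences-suc zero v w)
... | no  _ = occurrences-suc zero v w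

content-zerosThen : ∀ a (w : Row m) b w′ →
  content (zerosThen a w ++ zerosThen b w′) ≡ (a ℕ.+ b) ∷ content (w ++ w′)
content-zerosThen a w b w′ = cong₂ _∷_
  (trans (occurrences-++ zero (zerosThen a w) (zerosThen b w′))
         (cong₂ ℕ._+_ (occurrences-zero a w) (occurrences-zero b w′)))
  (tabulate-cong λ v → trans (occurrences-++ (suc v) (zerosThen a w) (zerosThen b w′))
    (trans (cong₂ ℕ._+_ (occurrences-suc a v w) (occurrences-suc b v w′))
           (sym (occurrences-++ v w w′))))

length-zerosThen : ∀ a (w : Row m) → length (zerosThen a w) ≡ a ℕ.+ length w
length-zerosThen a w = trans (length-++ (replicate a zero)) (cong₂ ℕ._+_ (length-replicate a) (length-map suc w))

sum-content : {w w′ : Row m} → Sorted w → Sorted w′ →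
  sum (content (w ++ w′)) ≡ length w ℕ.+ length w′
sum-content {zero}  {[]} {[]} _ _ = refl
sum-content {suc m} w↗ w′↗ with split-zeros w↗ | split-zeros w′↗
... | a , v , refl , v↗ | b , v′ , refl , v′↗ = begin
  sum (content (zerosThen a v ++ zerosThen b v′))  ≡⟨ cong sum (content-zerosThen a v b v′) ⟩
  (a ℕ.+ b) ℕ.+ sum (content (v ++ v′))            ≡⟨ cong ((a ℕ.+ b) ℕ.+_) (sum-content v↗ v′↗) ⟩
  (a ℕ.+ b) ℕ.+ (length v ℕ.+ length v′)           ≡⟨ ℕ-interchange a b (length v) (length v′) ⟩
  (a ℕ.+ length v) ℕ.+ (b ℕ.+ length v′)           ≡⟨ cong₂ ℕ._+_ (length-zerosThen a v) (length-zerosThen b v′) ⟨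
  length (zerosThen a v) ℕ.+ length (zerosThen b v′) ∎
  where open ≡-Reasoning

-- Skew tableaux with two rows, the lower of which starts s columns to the left
-- of the upper one and has length y

Rows : ℕ → Set
Rows m = Row m × Row m

Skew : (s y : ℕ) → Monomial → Rows m → Set
Skew s y e (r₁ , r₂) =
  Sorted r₁ × Sorted r₂ × Prefix _>ᶠ_ (drop s r₂) r₁ × content (r₁ ++ r₂) ≡ e × length r₂ ≡ y

topZeros : ℕ → Rows m → Rows (suc m)
topZeros r (r₁ , r₂) = zerosThen r r₁ , map suc r₂

bottomZero : Rows (suc m) → Rows (suc m)
bottomZero (r₁ , r₂) = r₁ , zero ∷ r₂

-- The r zeros go to the end of the lower row that sticks out, or to the upper
-- row; the entries other than zero then form a skew tableau again.
place lower : (s r y : ℕ) → (ℕ → ℕ → List (Rows m)) → List (Rows (suc m))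
place s r y K = map (topZeros r) (K (s ℕ.+ r) y) ++ lower s r y K
lower (suc s) (suc r) (suc y) K = map bottomZero (place s r y K)
lower _       _       _       K = []

-- Deleting the zeros of the upper row moves its start to the right, and deleting those of the lower
-- row brings the two starts closer. Straight shapes are not closed under this, hence the general
-- offset `s`.
skew : (s y : ℕ) (e : Monomial) → List (Rows (length e))
skew s zero    []      = [ ([] , []) ]
skew s (suc y) []      = []
skew s y       (r ∷ e) = place s r y λ s′ y′ → skew s′ y′ e

-- The first `r` entries of the lower row stand below zeros, which every successor exceeds; the
-- others are compared with the nonzero entries of the upper row.
drop-zerosThen⁺ : ∀ r {w w′ : Row m} → Prefix _>ᶠ_ (drop r w) w′ →
                  Prefix _>ᶠ_ (map suc w) (zerosThen r w′)
drop-zerosThen⁺ zero             p = Prefix.map⁺ suc suc (Prefix.map s≤s p)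
drop-zerosThen⁺ (suc r) {[]}     p = []
drop-zerosThen⁺ (suc r) {v ∷ w}  p = s≤s z≤n ∷ drop-zerosThen⁺ r p

drop-zerosThen⁻ : ∀ r {w w′ : Row m} → Prefix _>ᶠ_ (map suc w) (zerosThen r w′) →
                  Prefix _>ᶠ_ (drop r w) w′
drop-zerosThen⁻ zero             p       = Prefix.map ℕ.≤-pred (Prefix.map⁻ suc suc p)
drop-zerosThen⁻ (suc r) {[]}     p       = []
drop-zerosThen⁻ (suc r) {v ∷ w}  (_ ∷ p) = drop-zerosThen⁻ r p

drop-suc⁺ : ∀ s r {w w′ : Row m} → Prefix _>ᶠ_ (drop (s ℕ.+ r) w) w′ →
            Prefix _>ᶠ_ (drop s (map suc w)) (zerosThen r w′)
drop-suc⁺ zero    r         p = drop-zerosThen⁺ r p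
drop-suc⁺ (suc s) r {[]}    p = []
drop-suc⁺ (suc s) r {_ ∷ w} p = drop-suc⁺ s r p

drop-suc⁻ : ∀ s r {w w′ : Row m} → Prefix _>ᶠ_ (drop s (map suc w)) (zerosThen r w′) →
            Prefix _>ᶠ_ (drop (s ℕ.+ r) w) w′
drop-suc⁻ zero    r         p = drop-zerosThen⁻ r p
drop-suc⁻ (suc s) r {[]}    p = []
drop-suc⁻ (suc s) r {_ ∷ w} p = drop-suc⁻ s r p

topZeros-skew : ∀ s r {y e} {t : Rows m} → Skew (s ℕ.+ r) y e t → Skew s y (r ∷ e) (topZeros r t)
topZeros-skew s r {t = r₁ , r₂} (r₁↗ , r₂↗ , p , refl , refl) =
  zerosThen-sorted r r₁↗ , suc-sorted r₂↗ , drop-suc⁺ s r p ,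
  trans (content-zerosThen r r₁ 0 r₂) (cong (_∷ _) (ℕ.+-identityʳ r)) , length-map suc r₂

content-zero∷ : (w w′ : Row (suc m)) → ∀ {r e} → content (w ++ w′) ≡ r ∷ e →
                content (w ++ zero ∷ w′) ≡ suc r ∷ e
content-zero∷ w w′ {r} {e} eq = trans
  (cong₂ _∷_ (trans (occurrences-++ zero w (zero ∷ w′))
                    (trans (ℕ.+-suc _ _) (cong suc (sym (occurrences-++ zero w w′)))))
             (tabulate-cong λ v → trans (occurrences-++ (suc v) w (zero ∷ w′))
                                        (sym (occurrences-++ (suc v) w w′))))
  (cong₂ (λ a b → suc a ∷ b) (∷-injectiveˡ eq) (∷-injectiveʳ eq))

module _ {e : Monomial} {K : ℕ → ℕ → List (Rows m)}
         (K-sound : ∀ s y {t} → t ∈ K s y → Skew s y e t) where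

  place-sound : ∀ s r y {t} → t ∈ place s r y K → Skew s y (r ∷ e) t
  lower-sound : ∀ s r y {t} → t ∈ lower s r y K → Skew s y (r ∷ e) t
  place-sound s r y t∈ with ∈-++⁻ (map (topZeros r) (K (s ℕ.+ r) y)) t∈
  ... | inj₂ t∈low = lower-sound s r y t∈low
  ... | inj₁ t∈top with t′ , t′∈ , refl ← ∈-map⁻ (topZeros r) t∈top =
    topZeros-skew s r (K-sound (s ℕ.+ r) y t′∈)
  lower-sound (suc s) (suc r) (suc y) t∈ with ∈-map⁻ bottomZero t∈
  ... | (r₁ , r₂) , t′∈ , refl with place-sound s r y t′∈
  ... | r₁↗ , r₂↗ , p , c , l = r₁↗ , zero∷-sorted r₂↗ , p , content-zero∷ r₁ r₂ c , cong suc l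

skew-sound : ∀ s y e {t} → t ∈ skew s y e → Skew s y e t
skew-sound s zero    []      (here refl) = [] , [] , subst (λ w → Prefix _>ᶠ_ w []) (sym (drop-[] s)) [] , refl , refl
  where
  drop-[] : ∀ s → drop s ([] {A = Fin 0}) ≡ []
  drop-[] zero    = refl
  drop-[] (suc _) = refl
skew-sound s zero    (r ∷ e) t∈ = place-sound (λ s′ y′ → skew-sound s′ y′ e) s r zero t∈
skew-sound s (suc y) (r ∷ e) t∈ = place-sound (λ s′ y′ → skew-sound s′ y′ e) s r (suc y) t∈

module _ {e : Monomial} {K : ℕ → ℕ → List (Rows m)}
         (K-complete : ∀ s y {t} → Skew s y e t → t ∈ K s y) where

  place-complete : ∀ s r y a b {r₁ r₂ : Row m} → Sorted r₁ → Sorted r₂ →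
    Prefix _>ᶠ_ (drop s (zerosThen b r₂)) (zerosThen a r₁) →
    a ℕ.+ b ≡ r → content (r₁ ++ r₂) ≡ e → length (zerosThen b r₂) ≡ y →
    (zerosThen a r₁ , zerosThen b r₂) ∈ place s r y K
  place-complete s r y a zero {r₁} {r₂} r₁↗ r₂↗ p refl c l rewrite ℕ.+-identityʳ a =
    ∈-++⁺ˡ (∈-map⁺ (topZeros a) (K-complete (s ℕ.+ a) y
      (r₁↗ , r₂↗ , drop-suc⁻ s a p , c , trans (sym (length-map suc r₂)) l)))
  -- Without offset the first entry of the lower row stands below an entry of the upper row and
  -- exceeds it, so it is not zero.
  place-complete zero r y (suc a) (suc b) r₁↗ r₂↗ (() ∷ p) eq c l
  place-complete zero r y zero (suc b) {[]} r₁↗ r₂↗ () eq c l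
  place-complete zero r y zero (suc b) {_ ∷ _} r₁↗ r₂↗ (() ∷ p) eq c l
  place-complete (suc s) zero y a (suc b) r₁↗ r₂↗ p eq c l = contradiction (trans (sym (ℕ.+-suc a b)) eq) λ ()
  place-complete (suc s) (suc r) (suc y) a (suc b) {r₁} r₁↗ r₂↗ p eq c l =
    ∈-++⁺ʳ (map (topZeros (suc r)) (K (suc s ℕ.+ suc r) (suc y))) (∈-map⁺ bottomZero
      (place-complete s r y a b r₁↗ r₂↗ p (ℕ.suc-injective (trans (sym (ℕ.+-suc a b)) eq)) c (ℕ.suc-injective l)))

skew-complete : ∀ s y e {t} → Skew s y e t → t ∈ skew s y e
skew-complete s zero    []      {[] , []} _ = here refl
skew-complete s (suc y) []      {[] , []} (_ , _ , _ , _ , ())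
skew-complete s y       (r ∷ e) (r₁↗ , r₂↗ , p , c , l) with split-zeros r₁↗ | split-zeros r₂↗
... | a , w₁ , refl , w₁↗ | b , w₂ , refl , w₂↗
  with y | place-complete (λ s′ y′ → skew-complete s′ y′ e) s r y a b w₁↗ w₂↗ p
             (∷-injectiveˡ (trans (sym (content-zerosThen a w₁ b w₂)) c))
             (∷-injectiveʳ (trans (sym (content-zerosThen a w₁ b w₂)) c)) l
... | zero  | t∈ = t∈
... | suc _ | t∈ = t∈

zerosThen-injective : ∀ r {w w′ : Row m} → zerosThen r w ≡ zerosThen r w′ → w ≡ w′
zerosThen-injective r eq = map-injective Fin.suc-injective (++-cancelˡ (replicate r zero) _ _ eq)

topZeros-injective : ∀ r {t t′ : Rows m} → topZeros r t ≡ topZeros r t′ → t ≡ t′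
topZeros-injective r eq with eq₁ , eq₂ ← ,-injective eq =
  cong₂ _,_ (zerosThen-injective r eq₁) (map-injective Fin.suc-injective eq₂)

bottomZero-injective : {t t′ : Rows (suc m)} → bottomZero t ≡ bottomZero t′ → t ≡ t′
bottomZero-injective eq with eq₁ , eq₂ ← ,-injective eq = cong₂ _,_ eq₁ (∷-injectiveʳ eq₂)

module _ {K : ℕ → ℕ → List (Rows m)} (K! : ∀ s y → Unique (K s y)) where

  place-unique : ∀ s r y → Unique (place s r y K)
  lower-unique : ∀ s r y → Unique (lower s r y K)
  place-unique s r y = Unique.++⁺ (Unique.map⁺ (topZeros-injective r) (K! (s ℕ.+ r) y))
    (lower-unique s r y) λ (t∈top , t∈low) → disjoint s r y t∈top t∈low
    where
    -- A tableau of the first list has no zero in its lower row, while one of the second list has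
    -- its lower row begin with zero.
    disjoint : ∀ s r y {t} → t ∈ map (topZeros r) (K (s ℕ.+ r) y) → t ∉ lower s r y K
    disjoint (suc s) (suc r) (suc y) t∈top t∈low
      with ∈-map⁻ (topZeros (suc r)) t∈top | ∈-map⁻ bottomZero t∈low
    ... | (_ , []) , _ , refl | _ , _ , ()
    ... | (_ , _ ∷ _) , _ , refl | _ , _ , ()
  lower-unique (suc s) (suc r) (suc y) = Unique.map⁺ bottomZero-injective (place-unique s r y)
  lower-unique zero    r       y       = []
  lower-unique (suc s) zero    y       = []
  lower-unique (suc s) (suc r) zero    = []

skew-unique : ∀ s y e → Unique (skew s y e)
skew-unique s zero    []      = [] ∷ []
skew-unique s (suc y) []      = []
skew-unique s zero    (r ∷ e) = place-unique (λ s′ y′ → skew-unique s′ y′ e) s r zero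
skew-unique s (suc y) (r ∷ e) = place-unique (λ s′ y′ → skew-unique s′ y′ e) s r (suc y)

-- Weighted sums over skew tableaux

double : ℕ → ℕ
double zero    = 0
double (suc y) = suc (suc (double y))

private
  split-weight : ∀ a b c d → (a ℕ.+ b) ≡ c → + c * d ≡ + a * d + + b * d
  split-weight a b c d refl = ℤ.*-distribʳ-+ d (+ a) (+ b)

-- In use, `N` is the number of entries plus the offset, so `N ∸ double y` is the difference of the
-- row lengths of the outer shape; `d + y` records the factor t^y. For `g a = U a f` the sum is an
-- expansion in the polynomials `U`.
∑-weights : (t : ℕ → List (Rows m)) (g : ℕ → ℕ → ℤ) (Y N d : ℕ) → ℤ
∑-weights t g Y N d = ∑< Y λ y → + length (t y) * g (N ∸ double y) (d ℕ.+ y)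

-- The summand of y = 0 vanishes in the lower part, and shifting y there lowers
-- N by 2 and raises d by 1.
∑-weights-lower : ∀ s r (K : ℕ → ℕ → List (Rows m)) g Y N d →
  ∑-weights (λ y → lower (suc s) (suc r) y K) g (suc Y) (suc (suc N)) d
    ≡ ∑-weights (λ y → place s r y K) g Y N (suc d)
∑-weights-lower s r K g Y N d = trans (ℤ.+-identityˡ _) (∑<-cong Y λ y _ →
  cong₂ (λ l c → + l * g (N ∸ double y) c) (length-map bottomZero (place s r y K)) (ℕ.+-suc d y))

∑-weights-place : ∀ s r (K : ℕ → ℕ → List (Rows m)) g Y N d →
  ∑-weights (λ y → place s r y K) g Y N d
    ≡ ∑-weights (K (s ℕ.+ r)) g Y N d + ∑-weights (λ y → lower s r y K) g Y N d
∑-weights-place s r K g Y N d = trans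
  (∑<-cong Y λ y _ → split-weight (length (K (s ℕ.+ r) y)) (length (lower s r y K)) _ (g (N ∸ double y) (d ℕ.+ y))
    (sym (trans (length-++ (map (topZeros r) (K (s ℕ.+ r) y)))
                (cong (ℕ._+ length (lower s r y K)) (length-map (topZeros r) (K (s ℕ.+ r) y))))))
  (∑<-+ Y _ _)

module _ (f h : ℕ → ℤ) (S : ℕ) (K : ℕ → ℕ → List (Rows m))
  (K-sum : ∀ s Y d → s ℕ.+ S < double Y → ∑-weights (K s) (λ a → U a f) Y (s ℕ.+ S) d ≡ U s h d) where

  -- The tableaux with all zeros in the upper row account for `U (s + r)`. Those with a zero in the
  -- lower row account for the second term of `clebsch-gordan`, where `s` and `r` are lowered by
  -- one.
  place-sum : ∀ s r Y d → (s ℕ.+ r) ℕ.+ S < double Y →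
    ∑-weights (λ y → place s r y K) (λ a → U a f) Y ((s ℕ.+ r) ℕ.+ S) d ≡ U s (U r h) d
  place-sum s r Y d bound = trans (∑-weights-place s r K (λ a → U a f) Y _ d)
    (trans (cong (_+ _) (K-sum (s ℕ.+ r) Y d bound)) (by-shape s r Y bound))
    where
    by-shape : ∀ s r Y → (s ℕ.+ r) ℕ.+ S < double Y →
      U (s ℕ.+ r) h d + ∑-weights (λ y → lower s r y K) (λ a → U a f) Y ((s ℕ.+ r) ℕ.+ S) d ≡ U s (U r h) d
    by-shape zero r Y _ = trans (cong (_+_ (U r h d)) (∑<-zero Y λ y → refl)) (ℤ.+-identityʳ _)
    by-shape (suc s) zero Y _ rewrite ℕ.+-identityʳ s = trans
      (cong₂ _+_ (U-cong (suc s) (λ _ → refl) d) (∑<-zero Y λ y → refl)) (ℤ.+-identityʳ _)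
    by-shape (suc s) (suc r) (suc Y) bound rewrite ℕ.+-suc s r = trans
      (cong (_+_ (U (suc (suc (s ℕ.+ r))) h d)) (trans
        (∑-weights-lower s r K (λ a → U a f) Y ((s ℕ.+ r) ℕ.+ S) d)
        (place-sum s r Y (suc d) (ℕ.≤-pred (ℕ.≤-pred bound)))))
      (sym (clebsch-gordan s r h d))

-- Each letter contributes one factor `U r`, and `place-sum` expands the product again. For `s = 0`
-- the coefficients of this expansion are Kostka numbers of shapes with at most two rows.
skew-sum : ∀ (f : ℕ → ℤ) e s Y d → s ℕ.+ sum e < double Y →
  ∑-weights (λ y → skew s y e) (λ a → U a f) Y (s ℕ.+ sum e) d ≡ U s (U* e f) d
skew-sum f [] s (suc Y) d _ = trans
  (cong₂ _+_ (trans (ℤ.*-identityˡ _) (cong₂ (λ a → U a f) (ℕ.+-identityʳ s) (ℕ.+-identityʳ d)))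
             (∑<-zero Y λ y → refl))
  (ℤ.+-identityʳ _)
skew-sum f (r ∷ e) s Y d bound rewrite sym (ℕ.+-assoc s r (sum e)) = trans
  (∑<-cong Y λ y _ → cong (λ t → + length t * U (((s ℕ.+ r) ℕ.+ sum e) ∸ double y) f (d ℕ.+ y)) (by-y y))
  (place-sum f (U* e f) (sum e) (λ s′ y′ → skew s′ y′ e) (skew-sum f e) s r Y d bound)
  where
  by-y : ∀ y → skew s y (r ∷ e) ≡ place s r y λ s′ y′ → skew s′ y′ e
  by-y zero    = refl
  by-y (suc y) = refl

-- Two-row Schur functions

∈-words⁻ : ∀ {A : Set} (as : List A) n {w} → w ∈ words as n → length w ≡ n
∈-words⁻ as zero    (here refl) = refl
∈-words⁻ as (suc n) w∈ with ∈-cartesianProductWith⁻ _∷_ as (words as n) w∈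
... | _ , _ , _ , w∈ , refl = cong suc (∈-words⁻ as n w∈)

∈-words⁺ : ∀ n {w : Row m} → length w ≡ n → w ∈ words (allFin m) n
∈-words⁺ zero    {[]}    refl = here refl
∈-words⁺ (suc n) {v ∷ w} eq   =
  ∈-cartesianProductWith⁺ _∷_ (∈-allFin v) (∈-words⁺ n (ℕ.suc-injective eq))

words-unique : ∀ {A : Set} {as : List A} n → Unique as → Unique (words as n)
words-unique zero    as! = [] ∷ []
words-unique (suc n) as! = Unique.cartesianProductWith⁺ _∷_ ∷-injective as! (words-unique n as!)

fillings-unique : ∀ m rs → Unique (fillings m rs)
fillings-unique m []       = [] ∷ []
fillings-unique m (r ∷ rs) = Unique.cartesianProductWith⁺ _∷_ ∷-injective
  (words-unique r (Unique.allFin⁺ m)) (fillings-unique m rs)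

∈-fillings⁻ : ∀ rs {t : Tableau m} → t ∈ fillings m rs → map length t ≡ rs
∈-fillings⁻ {m} []       (here refl) = refl
∈-fillings⁻ {m} (r ∷ rs) t∈ with ∈-cartesianProductWith⁻ _∷_ (words (allFin m) r) (fillings m rs) t∈
... | _ , _ , w∈ , t∈ , refl = cong₂ _∷_ (∈-words⁻ (allFin m) r w∈) (∈-fillings⁻ rs t∈)

∈-fillings⁺ : ∀ rs {t : Tableau m} → map length t ≡ rs → t ∈ fillings m rs
∈-fillings⁺ []       {[]}    _  = here refl
∈-fillings⁺ (r ∷ rs) {w ∷ t} eq =
  ∈-cartesianProductWith⁺ _∷_ (∈-words⁺ r (∷-injectiveˡ eq)) (∈-fillings⁺ rs (∷-injectiveʳ eq))

-- `x` is the difference of the two lengths. Parts of a partition are positive, so an empty second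
-- row has to be dropped.
twoRows : (x b : ℕ) → List ℕ
twoRows x zero    = [ x ]
twoRows x (suc b) = x ℕ.+ suc b ∷ suc b ∷ []

tableau : ℕ → Rows m → Tableau m
tableau zero    (r₁ , r₂) = [ r₁ ]
tableau (suc b) (r₁ , r₂) = r₁ ∷ r₂ ∷ []

semistandardFillings : List ℕ → (e : Monomial) → List (Tableau (length e))
semistandardFillings rs e =
  filter (λ t → isSemistandard? t ×-dec (content (concat t) ≟ᴹ e)) (fillings (length e) rs)

tableau-injective : ∀ b {e} {t t′ : Rows m} → Skew 0 b e t → Skew 0 b e t′ → tableau b t ≡ tableau b t′ → t ≡ t′
tableau-injective zero    {t = _ , []} {_ , []} _ _ refl = refl
tableau-injective zero    {t = _ , _ ∷ _} (_ , _ , _ , _ , ())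
tableau-injective zero    {t = _ , []} {_ , _ ∷ _} _ (_ , _ , _ , _ , ())
tableau-injective (suc b) _ _ refl = refl

module _ (x : ℕ) (e : Monomial) where

  ∈-semistandard⁻ : ∀ b {t} → t ∈ semistandardFillings (twoRows x b) e →
    ∃ λ r → t ≡ tableau b r × Skew 0 b e r × length (proj₁ r) ≡ x ℕ.+ b
  ∈-semistandard⁻ b t∈
    with ∈-filter⁻ (λ t → isSemistandard? t ×-dec (content (concat t) ≟ᴹ e))
                   {xs = fillings (length e) (twoRows x b)} t∈
  ... | t∈fill , (rows↗ , columns) , c with b | ∈-fillings⁻ (twoRows x b) t∈fill | rows↗ | columns
  ∈-semistandard⁻ b {r ∷ []}       t∈ | _ , _ , c | zero  | eq | r↗ ∷ [] | _ =
    (r , []) , refl , (r↗ , [] , [] , c , refl) , trans (∷-injectiveˡ eq) (sym (ℕ.+-identityʳ x))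
  ∈-semistandard⁻ b {r₁ ∷ r₂ ∷ []} t∈ | _ , _ , c | suc _ | eq | r₁↗ ∷ r₂↗ ∷ [] | p ∷ _ =
    (r₁ , r₂) , refl , (r₁↗ , r₂↗ , p , trans (cong (λ r → content (r₁ ++ r)) (sym (++-identityʳ r₂))) c ,
                        ∷-injectiveˡ (∷-injectiveʳ eq)) , ∷-injectiveˡ eq

  ∈-semistandard⁺ : ∀ b {r} → Skew 0 b e r → length (proj₁ r) ≡ x ℕ.+ b →
    tableau b r ∈ semistandardFillings (twoRows x b) e
  ∈-semistandard⁺ zero {r , []} (r↗ , _ , _ , c , _) l =
    ∈-filter⁺ (λ t → isSemistandard? t ×-dec (content (concat t) ≟ᴹ e))
      (∈-fillings⁺ [ x ] (cong [_] (trans l (ℕ.+-identityʳ x)))) ((r↗ ∷ [] , [-]) , c)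
  ∈-semistandard⁺ (suc b) {r₁ , r₂} (r₁↗ , r₂↗ , p , c , l₂) l₁ =
    ∈-filter⁺ (λ t → isSemistandard? t ×-dec (content (concat t) ≟ᴹ e))
      (∈-fillings⁺ (twoRows x (suc b)) (cong₂ (λ k l → k ∷ l ∷ []) l₁ l₂))
      ((r₁↗ ∷ r₂↗ ∷ [] , p ∷ [-]) , trans (cong (λ r → content (r₁ ++ r)) (++-identityʳ r₂)) c)

  private
    total : ∀ b → (x ℕ.+ b) ℕ.+ b ≡ x ℕ.+ double b
    total b = trans (ℕ.+-assoc x b b) (cong (x ℕ.+_) (double-+ b))
      where
      double-+ : ∀ b → b ℕ.+ b ≡ double b
      double-+ zero    = refl
      double-+ (suc b) = cong suc (trans (ℕ.+-suc b b) (cong suc (double-+ b)))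

  sum-skew : ∀ {b} {r : Rows (length e)} → Skew 0 b e r → sum e ≡ length (proj₁ r) ℕ.+ b
  sum-skew (r₁↗ , r₂↗ , _ , c , refl) = trans (cong sum (sym c)) (sum-content r₁↗ r₂↗)

  semistandard-sum : ∀ b {t} → t ∈ semistandardFillings (twoRows x b) e → sum e ≡ x ℕ.+ double b
  semistandard-sum b t∈ with ∈-semistandard⁻ b t∈
  ... | _ , _ , sk , l = trans (sum-skew sk) (trans (cong (ℕ._+ b) l) (total b))

  -- `Skew 0 b e` prescribes the length of the lower row only; that of the upper row follows from
  -- `sum e`.
  kostka : ∀ b → sum e ≡ x ℕ.+ double b →
           length (skew 0 b e) ≡ length (semistandardFillings (twoRows x b) e)
  kostka b sum≡ = length-bijection (tableau b)
    (λ t∈ t′∈ → tableau-injective b (skew-sound 0 b e t∈) (skew-sound 0 b e t′∈))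
    (skew-unique 0 b e)
    (Unique.filter⁺ (λ t → isSemistandard? t ×-dec (content (concat t) ≟ᴹ e))
      (fillings-unique (length e) (twoRows x b)))
    (λ r∈ → let sk = skew-sound 0 b e r∈ in ∈-semistandard⁺ b sk
      (ℕ.+-cancelʳ-≡ b _ _ (trans (sym (sum-skew sk)) (trans sum≡ (sym (total b))))))
    λ t∈ → case ∈-semistandard⁻ b t∈ of λ { (r , eq , sk , _) → r , skew-complete 0 b e sk , eq }

-- Coefficients of fundamental quasisymmetric functions

bit : Subset n → ℕ → Bool
bit Vec.[]      _       = false
bit (b Vec.∷ J) zero    = b
bit (b Vec.∷ J) (suc j) = bit J j

-- Cutting the positions into consecutive segments of the given lengths, no
-- descent lies strictly inside a segment.
descentFree : List ℕ → (ℕ → Bool) → Bool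
descentFree []                d = true
descentFree (0 ∷ e)           d = descentFree e d
descentFree (1 ∷ e)           d = descentFree e (d ∘ suc)
descentFree (suc (suc a) ∷ e) d = not (d 0) ∧ descentFree (suc a ∷ e) (d ∘ suc)

Admissibleˡ : (ℕ → Bool) → Row m → Set
Admissibleˡ d []          = ⊤
Admissibleˡ d (_ ∷ [])    = ⊤
Admissibleˡ d (x ∷ y ∷ w) = (x ≤ᶠ y × (IsTrue (d 0) → x <ᶠ y)) × Admissibleˡ (d ∘ suc) (y ∷ w)

admissible⇒ : ∀ (J : Subset n) (i : Vec (Fin m) (suc n)) → Admissible J i → Admissibleˡ (bit J) (toList i)
admissible⇒ Vec.[]      (x Vec.∷ Vec.[])    _   = tt
admissible⇒ (b Vec.∷ J) (x Vec.∷ y Vec.∷ i) adm =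
  (proj₁ (adm zero) , λ { tb → proj₂ (adm zero) (here′ b tb) }) ,
  admissible⇒ J (y Vec.∷ i) λ j → proj₁ (adm (suc j)) , λ j∈ → proj₂ (adm (suc j)) (Vec.there j∈)
  where
  here′ : ∀ b → IsTrue b → (b Vec.∷ J) Vec.[ zero ]= true
  here′ true _ = Vec.here

admissible⇐ : ∀ (J : Subset n) (i : Vec (Fin m) (suc n)) → Admissibleˡ (bit J) (toList i) → Admissible J i
admissible⇐ (b Vec.∷ J) (x Vec.∷ y Vec.∷ i) ((x≤y , x<y) , _)   zero    = x≤y , λ { Vec.here → x<y tt }
admissible⇐ (b Vec.∷ J) (x Vec.∷ y Vec.∷ i) (_ , adm) (suc j) with admissible⇐ J (y Vec.∷ i) adm j
... | le , lt = le , λ { (Vec.there j∈) → lt j∈ }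

admissible-sorted : ∀ {d} (w : Row m) → Admissibleˡ d w → Sorted w
admissible-sorted []          _                 = []
admissible-sorted (_ ∷ [])    _                 = [-]
admissible-sorted (_ ∷ y ∷ w) ((x≤y , _) , adm) = x≤y ∷ admissible-sorted (y ∷ w) adm

-- This is the only weakly increasing word of content `e`, which makes every coefficient of a
-- fundamental quasisymmetric function zero or one.
sortedWord : (e : Monomial) → Row (length e)
sortedWord []      = []
sortedWord (a ∷ e) = zerosThen a (sortedWord e)

content-zerosThen₁ : ∀ a (w : Row m) → content (zerosThen a w) ≡ a ∷ content w
content-zerosThen₁ a w = cong₂ _∷_ (occurrences-zero a w) (tabulate-cong λ v → occurrences-suc a v w)

content-sortedWord : ∀ e → content (sortedWord e) ≡ e
content-sortedWord []      = refl
content-sortedWord (a ∷ e) = trans (content-zerosThen₁ a (sortedWord e)) (cong (a ∷_) (content-sortedWord e))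

length-sortedWord : ∀ e → length (sortedWord e) ≡ sum e
length-sortedWord []      = refl
length-sortedWord (a ∷ e) = trans (length-zerosThen a (sortedWord e)) (cong (a ℕ.+_) (length-sortedWord e))

sortedWord-unique : ∀ e {w} → Sorted w → content w ≡ e → w ≡ sortedWord e
sortedWord-unique []      {[]} _  _ = refl
sortedWord-unique (a ∷ e) w↗ c with split-zeros w↗
... | b , w , refl , w↗ with ∷-injective (trans (sym (content-zerosThen₁ b w)) c)
... | refl , c′ = cong (zerosThen b) (sortedWord-unique e w↗ c′)

admissible-suc⇒ : ∀ {d} (w : Row m) → Admissibleˡ d (map suc w) → Admissibleˡ d w
admissible-suc⇒ []          _ = tt
admissible-suc⇒ (_ ∷ [])    _ = tt
admissible-suc⇒ (_ ∷ y ∷ w) ((le , lt) , adm) = (ℕ.≤-pred le , ℕ.≤-pred ∘ lt) , admissible-suc⇒ (y ∷ w) adm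

admissible-suc⇐ : ∀ {d} (w : Row m) → Admissibleˡ d w → Admissibleˡ d (map suc w)
admissible-suc⇐ []          _ = tt
admissible-suc⇐ (_ ∷ [])    _ = tt
admissible-suc⇐ (_ ∷ y ∷ w) ((le , lt) , adm) = (s≤s le , s≤s ∘ lt) , admissible-suc⇐ (y ∷ w) adm

notAnd⁺ : ∀ {b c} → ¬ IsTrue b → IsTrue c → IsTrue (not b ∧ c)
notAnd⁺ {false} _  c = c
notAnd⁺ {true}  ¬b _ = ¬b tt

notAnd⁻ : ∀ {b c} → IsTrue (not b ∧ c) → ¬ IsTrue b × IsTrue c
notAnd⁻ {false} c = (λ ()) , c

admissible⇒descentFree : ∀ e d → Admissibleˡ d (sortedWord e) → IsTrue (descentFree e d)
admissible⇒descentFree []                d adm = tt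
admissible⇒descentFree (0 ∷ e)           d adm = admissible⇒descentFree e d (admissible-suc⇒ (sortedWord e) adm)
admissible⇒descentFree (1 ∷ e)           d adm =
  admissible⇒descentFree e (d ∘ suc) (admissible-suc⇒ (sortedWord e) (tail (sortedWord e) adm))
  where
  tail : ∀ (w : Row m) → Admissibleˡ d (zero ∷ map suc w) → Admissibleˡ (d ∘ suc) (map suc w)
  tail []      _         = tt
  tail (_ ∷ _) (_ , adm) = adm
admissible⇒descentFree (suc (suc a) ∷ e) d ((_ , lt) , adm) =
  notAnd⁺ (λ d₀ → contradiction (lt d₀) λ ()) (admissible⇒descentFree (suc a ∷ e) (d ∘ suc) adm)

descentFree⇒admissible : ∀ e d → IsTrue (descentFree e d) → Admissibleˡ d (sortedWord e)
descentFree⇒admissible []                d free = tt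
descentFree⇒admissible (0 ∷ e)           d free = admissible-suc⇐ (sortedWord e) (descentFree⇒admissible e d free)
descentFree⇒admissible (1 ∷ e)           d free =
  tail (sortedWord e) (admissible-suc⇐ (sortedWord e) (descentFree⇒admissible e (d ∘ suc) free))
  where
  tail : ∀ (w : Row m) → Admissibleˡ (d ∘ suc) (map suc w) → Admissibleˡ d (zero ∷ map suc w)
  tail []      _   = tt
  tail (_ ∷ _) adm = (z≤n , λ _ → s≤s z≤n) , adm
descentFree⇒admissible (suc (suc a) ∷ e) d free =
  (z≤n , λ d₀ → contradiction d₀ (proj₁ (notAnd⁻ free))) ,
  descentFree⇒admissible (suc a ∷ e) (d ∘ suc) (proj₂ (notAnd⁻ free))

vectors-unique : ∀ {A : Set} {as : List A} n → Unique as → Unique (vectors as n)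
vectors-unique zero    as! = [] ∷ []
vectors-unique (suc n) as! = Unique.cartesianProductWith⁺ Vec._∷_ Vec.∷-injective as! (vectors-unique n as!)

∈-vectors : (i : Vec (Fin m) n) → i ∈ vectors (allFin m) n
∈-vectors Vec.[]      = here refl
∈-vectors (v Vec.∷ i) = ∈-cartesianProductWith⁺ Vec._∷_ (∈-allFin v) (∈-vectors i)

toList-injective : ∀ {A : Set} (i i′ : Vec A n) → toList i ≡ toList i′ → i ≡ i′
toList-injective Vec.[]      Vec.[]        _  = refl
toList-injective (x Vec.∷ i) (x′ Vec.∷ i′) eq =
  cong₂ Vec._∷_ (∷-injectiveˡ eq) (toList-injective i i′ (∷-injectiveʳ eq))

ofLength : ∀ {A : Set} (w : List A) → length w ≡ n → ∃ λ (i : Vec A n) → toList i ≡ w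
ofLength w refl = Vec.fromList w , Vec.toList∘fromList w

⟦_⟧ : Bool → ℤ
⟦ true  ⟧ = 1ℤ
⟦ false ⟧ = 0ℤ

module _ {n} (J : Subset n) (e : Monomial) where

  private
    P? = λ (i : Vec (Fin (length e)) (suc n)) → admissible? J i ×-dec (content (toList i) ≟ᴹ e)

    supported : ∀ {i} → i ∈ filter P? (vectors (allFin (length e)) (suc n)) →
      toList i ≡ sortedWord e × IsTrue (descentFree e (bit J)) × sum e ≡ suc n
    supported {i} i∈ with ∈-filter⁻ P? {xs = vectors (allFin (length e)) (suc n)} i∈
    ... | _ , adm , c with adm′ ← admissible⇒ J i adm
                         | eq ← sortedWord-unique e (admissible-sorted (toList i) (admissible⇒ J i adm)) c =
      eq , admissible⇒descentFree e (bit J) (subst (Admissibleˡ (bit J)) eq adm′) ,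
      trans (sym (length-sortedWord e)) (trans (cong length (sym eq)) (Vec.length-toList i))

    coefficient : ∀ ys → Unique ys →
      (∀ {i} → i ∈ filter P? (vectors (allFin (length e)) (suc n)) → toList i ∈ ys) →
      (∀ {w} → w ∈ ys → w ≡ sortedWord e × IsTrue (descentFree e (bit J)) × sum e ≡ suc n) →
      𝓕 (suc n) J e ≡ + length ys
    coefficient ys ys! into sound = cong +_ (length-bijection toList
      (λ _ _ → toList-injective _ _)
      (Unique.filter⁺ P? (vectors-unique (suc n) (Unique.allFin⁺ (length e)))) ys! into λ w∈ → onto (sound w∈))
      where
      onto : ∀ {w} → w ≡ sortedWord e × IsTrue (descentFree e (bit J)) × sum e ≡ suc n →
        ∃ λ i → i ∈ filter P? (vectors (allFin (length e)) (suc n)) × w ≡ toList i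
      onto (refl , free , sum≡) with ofLength (sortedWord e) (trans (length-sortedWord e) sum≡)
      ... | i , eq = i , ∈-filter⁺ P? (∈-vectors i)
        (admissible⇐ J i (subst (Admissibleˡ (bit J)) (sym eq) (descentFree⇒admissible e (bit J) free)) ,
         trans (cong content eq) (content-sortedWord e)) , sym eq

  -- The one candidate is `sortedWord e`. Its runs of equal letters are the segments of `e`, and
  -- strictly inside a run no strict increase is possible.
  𝓕-coefficient : sum e ≡ suc n → 𝓕 (suc n) J e ≡ ⟦ descentFree e (bit J) ⟧
  𝓕-coefficient sum≡ with descentFree e (bit J) in eq
  ... | true  = coefficient [ sortedWord e ] ([] ∷ []) (λ i∈ → here (proj₁ (supported i∈)))
                  λ { (here refl) → refl , subst IsTrue (sym eq) tt , sum≡ }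
  ... | false = coefficient [] [] (λ i∈ → contradiction (subst IsTrue eq (proj₁ (proj₂ (supported i∈)))) λ ()) λ ()

  𝓕-homogeneous : sum e ≢ suc n → 𝓕 (suc n) J e ≡ 0ℤ
  𝓕-homogeneous sum≢ = coefficient [] [] (λ i∈ → contradiction (proj₂ (proj₂ (supported i∈))) sum≢) λ ()

-- A word prescribes descents at the beginning of a composition: true is a
-- segment of length 2 with a descent in it, false a segment of length 1.
prescribed : List Bool → List ℕ → (ℕ → Bool) → Bool
prescribed []          e d = descentFree e d
prescribed (true  ∷ u) e d = d 0 ∧ prescribed u e (λ j → d (2 ℕ.+ j))
prescribed (false ∷ u) e d = prescribed u e (d ∘ suc)

size : List Bool → ℕ
size []          = 0
size (true  ∷ u) = 2 ℕ.+ size u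
size (false ∷ u) = 1 ℕ.+ size u

trues : List Bool → ℕ
trues []          = 0
trues (true  ∷ u) = suc (trues u)
trues (false ∷ u) = trues u

Sparse : (ℕ → Bool) → Set
Sparse d = ∀ j → d j ≡ true → d (suc j) ≡ false

-- Cutting off the first entry of a segment of length a + 2 admits a descent at the cut. If there is
-- one, sparseness forbids the next position, so that a descent pair followed by a segment of length
-- a remains. This is the recursion of `U`, with one shift for each descent pair.
prescribed-split : ∀ u a e {d} → Sparse d →
  ⟦ prescribed u (suc (suc a) ∷ e) d ⟧ + ⟦ prescribed (u ∷ʳ true) (a ∷ e) d ⟧
    ≡ ⟦ prescribed (u ∷ʳ false) (suc a ∷ e) d ⟧
prescribed-split (true ∷ u)  a e {d} sp with d 0
... | true  = prescribed-split u a e (sp ∘ (2 ℕ.+_))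
... | false = refl
prescribed-split (false ∷ u) a e {d} sp = prescribed-split u a e (sp ∘ suc)
prescribed-split []          a e {d} sp with d 0 in d₀
... | false = ℤ.+-identityʳ _
... | true  = trans (ℤ.+-identityˡ _) (cong ⟦_⟧ (skip a))
  where
  skip : ∀ a → descentFree (a ∷ e) (λ j → d (2 ℕ.+ j)) ≡ descentFree (suc a ∷ e) (d ∘ suc)
  skip zero    = refl
  skip (suc a) rewrite sp 0 d₀ = refl

prescribed-false∷ : ∀ u e d → prescribed u (1 ∷ e) d ≡ prescribed (u ∷ʳ false) e d
prescribed-false∷ []          e d = refl
prescribed-false∷ (true  ∷ u) e d = cong (d 0 ∧_) (prescribed-false∷ u e _)
prescribed-false∷ (false ∷ u) e d = prescribed-false∷ u e _

prescribed-zero∷ : ∀ u e d → prescribed u (0 ∷ e) d ≡ prescribed u e d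
prescribed-zero∷ []          e d = refl
prescribed-zero∷ (true  ∷ u) e d = cong (d 0 ∧_) (prescribed-zero∷ u e _)
prescribed-zero∷ (false ∷ u) e d = prescribed-zero∷ u e _

size-++ : ∀ u v → size (u ++ v) ≡ size u ℕ.+ size v
size-++ []          v = refl
size-++ (true  ∷ u) v = cong (2 ℕ.+_) (size-++ u v)
size-++ (false ∷ u) v = cong suc (size-++ u v)

size-∷ʳ-true : ∀ u k → size (u ∷ʳ true) ℕ.+ k ≡ size u ℕ.+ suc (suc k)
size-∷ʳ-true u k rewrite size-++ u [ true ] = ℕ.+-assoc (size u) 2 k

size-∷ʳ-false : ∀ u k → size (u ∷ʳ false) ℕ.+ k ≡ size u ℕ.+ suc k
size-∷ʳ-false u k rewrite size-++ u [ false ] = ℕ.+-assoc (size u) 1 k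

trues-∷ʳ-true : ∀ u → trues (u ∷ʳ true) ≡ suc (trues u)
trues-∷ʳ-true []          = refl
trues-∷ʳ-true (true  ∷ u) = cong suc (trues-∷ʳ-true u)
trues-∷ʳ-true (false ∷ u) = trues-∷ʳ-true u

trues-∷ʳ-false : ∀ u → trues (u ∷ʳ false) ≡ trues u
trues-∷ʳ-false []          = refl
trues-∷ʳ-false (true  ∷ u) = cong suc (trues-∷ʳ-false u)
trues-∷ʳ-false (false ∷ u) = trues-∷ʳ-false u

size-↭ : ∀ {u v} → u ↭ v → size u ≡ size v
size-↭ Perm.refl                  = refl
size-↭ (Perm.prep true p)         = cong (2 ℕ.+_) (size-↭ p)
size-↭ (Perm.prep false p)        = cong suc (size-↭ p)
size-↭ (Perm.swap true true p)    = cong (4 ℕ.+_) (size-↭ p)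
size-↭ (Perm.swap true false p)   = cong (3 ℕ.+_) (size-↭ p)
size-↭ (Perm.swap false true p)   = cong (3 ℕ.+_) (size-↭ p)
size-↭ (Perm.swap false false p)  = cong (2 ℕ.+_) (size-↭ p)
size-↭ (Perm.trans p q)           = trans (size-↭ p) (size-↭ q)

truesFirst : ℕ → ℕ → List Bool
truesFirst d k = replicate d true ++ replicate k false

-- Size and number of trues determine a word up to order, as each true takes two places and each
-- false takes one.
truesFirst-↭ : ∀ u → u ↭ truesFirst (trues u) (size u ∸ double (trues u))
truesFirst-↭ u = subst (λ k → u ↭ truesFirst (trues u) k) (falses≡ u) (sorted u)
  where
  falses : List Bool → ℕ
  falses []          = 0
  falses (true  ∷ u) = falses u
  falses (false ∷ u) = suc (falses u)

  size≡ : ∀ u → size u ≡ falses u ℕ.+ double (trues u)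
  size≡ []          = refl
  size≡ (true  ∷ u) = trans (cong (2 ℕ.+_) (size≡ u))
    (sym (trans (ℕ.+-suc (falses u) _) (cong suc (ℕ.+-suc (falses u) _))))
  size≡ (false ∷ u) = cong suc (size≡ u)

  falses≡ : ∀ u → falses u ≡ size u ∸ double (trues u)
  falses≡ u = sym (trans (cong (_∸ double (trues u)) (size≡ u)) (ℕ.m+n∸n≡m (falses u) (double (trues u))))

  sorted : ∀ u → u ↭ truesFirst (trues u) (falses u)
  sorted []          = Perm.refl
  sorted (true  ∷ u) = Perm.prep true (sorted u)
  sorted (false ∷ u) = Perm.trans (Perm.prep false (sorted u))
    (Perm.↭-sym (shift false (replicate (trues u) true) (replicate (falses u) false)))

-- Symmetry and Schur-positivity from sparse descents and the exchange property

U*-∷ʳ-0 : ∀ e f d → U* (e ∷ʳ 0) f d ≡ U* e f d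
U*-∷ʳ-0 []      f d = refl
U*-∷ʳ-0 (a ∷ e) f d = U-cong a (U*-∷ʳ-0 e f) d

U*-↭ : ∀ {e e′} → e ↭ e′ → ∀ f d → U* e f d ≡ U* e′ f d
U*-↭ Perm.refl                         f d = refl
U*-↭ (Perm.prep a p)                   f d = U-cong a (U*-↭ p f) d
U*-↭ (Perm.swap {ys = e′} a b p)       f d =
  trans (U-cong a (λ c → U-cong b (U*-↭ p f) c) d) (U-comm a b (U* e′ f) d)
U*-↭ (Perm.trans p q)                  f d = trans (U*-↭ p f d) (U*-↭ q f d)

-- `Y` is floor(n/2) + 1, the number of partitions of `n` with at most two rows.
half : ∀ n → ∃ λ Y → n < double Y × (∀ y → y < Y → double y ≤ n)
half 0             = 1 , s≤s z≤n , λ { zero _ → z≤n ; (suc _) (s≤s ()) }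
half 1             = 1 , s≤s (s≤s z≤n) , λ { zero _ → z≤n ; (suc _) (s≤s ()) }
half (suc (suc n)) with Y , n< , ≤n ← half n =
  suc Y , s≤s (s≤s n<) , λ { zero _ → z≤n ; (suc y) (s≤s y<) → s≤s (s≤s (≤n y y<)) }

⟦⟧-nonneg : ∀ b → 0ℤ ℤ.≤ ⟦ b ⟧
⟦⟧-nonneg true  = ℤ.+≤+ z≤n
⟦⟧-nonneg false = ℤ.+≤+ z≤n

∑-nonneg : ∀ {A : Set} (as : List A) F → (∀ a → 0ℤ ℤ.≤ F a) → 0ℤ ℤ.≤ ∑ as F
∑-nonneg []       F F≥0 = ℤ.≤-refl
∑-nonneg (a ∷ as) F F≥0 = ℤ.+-mono-≤ (F≥0 a) (∑-nonneg as F F≥0)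

twoRowPartition : ∀ n → 0 < n → ℕ → Partition
twoRowPartition n n>0 b = record
  { parts      = twoRows (n ∸ double b) b
  ; positive   = pos b
  ; decreasing = dec (n ∸ double b) b
  }
  where
  pos : ∀ b → All (0 <_) (twoRows (n ∸ double b) b)
  pos zero    = n>0 ∷ []
  pos (suc b) = ℕ.≤-trans (s≤s z≤n) (ℕ.m≤n+m (suc b) (n ∸ double (suc b))) ∷ s≤s z≤n ∷ []
  dec : ∀ x b → Linked ℕ._≥_ (twoRows x b)
  dec x zero    = [-]
  dec x (suc b) = ℕ.m≤n+m (suc b) x ∷ [-]

twoRows-injective : ∀ {x x′} b b′ → twoRows x b ≡ twoRows x′ b′ → b ≡ b′
twoRows-injective zero    zero     _    = refl
twoRows-injective (suc b) (suc b′) eq   = ∷-injectiveˡ (∷-injectiveʳ eq)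

module _ {n} (ps : List (Blocks (suc n)))
  (sparse : ∀ {p} → p ∈ ps → Sparse (bit (Des p)))
  (exchange : ∀ u v → size (u ++ true ∷ false ∷ v) ≡ suc n →
    ∑ ps (λ p → ⟦ prescribed (u ++ true ∷ false ∷ v) [] (bit (Des p)) ⟧)
      ≡ ∑ ps (λ p → ⟦ prescribed (u ++ false ∷ true ∷ v) [] (bit (Des p)) ⟧)) where

  count : List Bool → List ℕ → ℤ
  count u e = ∑ ps λ p → ⟦ prescribed u e (bit (Des p)) ⟧

  extend : ∀ w b u v →
    (size ((w ∷ʳ b) ++ u) ≡ suc n → count ((w ∷ʳ b) ++ u) [] ≡ count ((w ∷ʳ b) ++ v) []) →
    size (w ++ b ∷ u) ≡ suc n → count (w ++ b ∷ u) [] ≡ count (w ++ b ∷ v) []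
  extend w b u v rewrite ∷ʳ-++ w b u | ∷ʳ-++ w b v = λ hyp → hyp

  -- Transpositions of neighbours generate all rearrangements. The accumulator `w` is the common
  -- beginning that the recursion has passed, as `exchange` speaks of whole words.
  count-↭ : ∀ w {u v} → u ↭ v → size (w ++ u) ≡ suc n → count (w ++ u) [] ≡ count (w ++ v) []
  count-↭ w Perm.refl _ = refl
  count-↭ w {_ ∷ u} {_ ∷ v} (Perm.prep b p) size≡ = extend w b u v (count-↭ (w ∷ʳ b) p) size≡
  count-↭ w {_ ∷ _ ∷ u} {_ ∷ _ ∷ v} (Perm.swap b c p) size≡ = trans
    (extend w b (c ∷ u) (c ∷ v) (extend (w ∷ʳ b) c u v (count-↭ ((w ∷ʳ b) ∷ʳ c) p)) size≡)
    (switch b c (trans (trans (size-++ w _) (trans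
      (cong (size w ℕ.+_) (sym (size-↭ (Perm.prep b (Perm.prep c p))))) (sym (size-++ w _)))) size≡))
    where
    switch : ∀ b c → size (w ++ b ∷ c ∷ v) ≡ suc n → count (w ++ b ∷ c ∷ v) [] ≡ count (w ++ c ∷ b ∷ v) []
    switch true  true  _     = refl
    switch true  false size≡ = exchange w v size≡
    switch false true  size≡ = sym (exchange w v (trans (trans (size-++ w _) (sym (size-++ w _))) size≡))
    switch false false _     = refl
  count-↭ w {u} {v} (Perm.trans {ys = y} p q) size≡ = trans (count-↭ w p size≡)
    (count-↭ w q (trans (trans (size-++ w y) (trans (cong (size w ℕ.+_) (sym (size-↭ p))) (sym (size-++ w u)))) size≡))

  -- The word with its descents first stands for all words of size `suc n` with `d` trues: by
  -- `count-↭` they have the same count.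
  ν : ℕ → ℤ
  ν d = count (truesFirst d (suc n ∸ double d)) []

  -- The word `u` collects what has been prescribed so far. `prescribed-split` turns a long segment
  -- into a difference of two shorter problems, in step with the recursion of `U`; a descent pair
  -- added to `u` is one shift. Once `e` is used up, only `trues u` matters.
  count-U* : ∀ e u → size u ℕ.+ sum e ≡ suc n → count u e ≡ U* e ν (trues u)
  count-U* [] u size≡ = trans (count-↭ [] (truesFirst-↭ u) size-u)
    (cong (λ k → count (truesFirst (trues u) (k ∸ double (trues u))) []) size-u)
    where
    size-u : size u ≡ suc n
    size-u = trans (sym (ℕ.+-identityʳ (size u))) size≡
  count-U* (0 ∷ e) u size≡ = trans
    (∑-cong ps λ {p} _ → cong ⟦_⟧ (prescribed-zero∷ u e (bit (Des p)))) (count-U* e u size≡)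
  count-U* (1 ∷ e) u size≡ = trans
    (∑-cong ps λ {p} _ → cong ⟦_⟧ (prescribed-false∷ u e (bit (Des p))))
    (trans (count-U* e (u ∷ʳ false) (trans (size-∷ʳ-false u (sum e)) size≡))
           (cong (U* e ν) (trues-∷ʳ-false u)))
  count-U* (suc (suc a) ∷ e) u size≡ = solve-difference (trans
    (sym (∑-+ ps _ _))
    (∑-cong ps λ {p} p∈ → prescribed-split u a e (sparse p∈)))
    (trans (count-U* (suc a ∷ e) (u ∷ʳ false) (trans (size-∷ʳ-false u (sum (suc a ∷ e))) size≡))
           (cong (U* (suc a ∷ e) ν) (trues-∷ʳ-false u)))
    (trans (count-U* (a ∷ e) (u ∷ʳ true) (trans (size-∷ʳ-true u (sum (a ∷ e))) size≡))
           (cong (U* (a ∷ e) ν) (trues-∷ʳ-true u)))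
    where
    add-sub : ∀ x y → x ≡ (x + y) - y
    add-sub = solve-∀
    solve-difference : ∀ {x y z y′ z′} → x + y ≡ z → z ≡ z′ → y ≡ y′ → x ≡ z′ - y′
    solve-difference {x} {y} refl refl refl = add-sub x y

  𝓠-coefficient : ∀ e → sum e ≡ suc n → 𝓠 ps e ≡ U* e ν 0
  𝓠-coefficient e sum≡ = trans (∑-cong ps λ {p} _ → 𝓕-coefficient (Des p) e sum≡) (count-U* e [] sum≡)

  𝓠-homogeneous : ∀ e → sum e ≢ suc n → 𝓠 ps e ≡ 0ℤ
  𝓠-homogeneous e sum≢ = ∑-zero ps λ p → 𝓕-homogeneous (Des p) e sum≢

  𝓠-cong : ∀ e e′ → sum e ≡ sum e′ → (∀ d → U* e ν d ≡ U* e′ ν d) → 𝓠 ps e ≡ 𝓠 ps e′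
  𝓠-cong e e′ sums U*≡ with sum e ℕ.≟ suc n
  ... | yes eq = trans (𝓠-coefficient e eq) (trans (U*≡ 0) (sym (𝓠-coefficient e′ (trans (sym sums) eq))))
  ... | no neq = trans (𝓠-homogeneous e neq) (sym (𝓠-homogeneous e′ (neq ∘ trans sums)))

  𝓠-symmetric : IsSymmetric (𝓠 ps)
  𝓠-symmetric = record
    { stable    = λ e → 𝓠-cong (e ∷ʳ 0) e (trans (sum-++ e [ 0 ]) (ℕ.+-identityʳ (sum e))) (U*-∷ʳ-0 e ν)
    ; bounded   = suc n , λ e n<sum → 𝓠-homogeneous e λ sum≡ → ℕ.<-irrefl (sym sum≡) n<sum
    ; invariant = λ {e} {e′} p → 𝓠-cong e e′ (sum-↭ p) (U*-↭ p ν)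
    }

  trues-replicate : ∀ b → trues (replicate b true) ≡ b
  trues-replicate zero    = refl
  trues-replicate (suc b) = cong suc (trues-replicate b)

  size-replicate : ∀ b → size (replicate b true) ≡ double b
  size-replicate zero    = refl
  size-replicate (suc b) = cong (2 ℕ.+_) (size-replicate b)

  -- Defined as a count and not through `U`, whose recursion subtracts, so that it is visibly
  -- nonnegative.
  multiplicity : ℕ → ℤ
  multiplicity b = count (replicate b true) [ suc n ∸ double b ]

  multiplicity-U : ∀ b → double b ≤ suc n → multiplicity b ≡ U (suc n ∸ double b) ν b
  multiplicity-U b le = trans
    (count-U* [ suc n ∸ double b ] (replicate b true)
      (trans (cong₂ ℕ._+_ (size-replicate b) (ℕ.+-identityʳ _)) (ℕ.m+[n∸m]≡n le)))
    (cong (U (suc n ∸ double b) ν) (trues-replicate b))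

  term : ℕ → ℤ × Partition
  term b = multiplicity b , twoRowPartition (suc n) (s≤s z≤n) b

  -- In degree n + 1 this is `skew-sum` without offset, applied to `ν`; in every other degree both
  -- sides vanish.
  𝓠-expansion : ∀ Y → suc n < double Y → (∀ y → y < Y → double y ≤ suc n) →
    ∀ e → 𝓠 ps e ≡ ∑< Y λ b → multiplicity b * schur (proj₂ (term b)) e
  𝓠-expansion Y n< ≤n e with sum e ℕ.≟ suc n
  ... | yes sum≡ = trans (𝓠-coefficient e sum≡) (trans
      (sym (skew-sum ν e 0 Y 0 (subst (_< double Y) (sym sum≡) n<)))
      (∑<-cong Y λ y y<Y → trans (ℤ.*-comm (+ length (skew 0 y e)) _) (cong₂ _*_
        (trans (cong (λ k → U (k ∸ double y) ν y) sum≡) (sym (multiplicity-U y (≤n y y<Y))))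
        (cong +_ (kostka (suc n ∸ double y) e y (trans sum≡ (sym (ℕ.m∸n+n≡m (≤n y y<Y)))))))))
  ... | no sum≢  = trans (𝓠-homogeneous e sum≢) (sym (trans
      (∑<-cong Y λ y y<Y → trans (cong (multiplicity y *_) (vanish y (≤n y y<Y))) (ℤ.*-zeroʳ (multiplicity y)))
      (∑<-zero Y λ _ → refl)))
    where
    empty : ∀ {A : Set} (as : List A) → (∀ {a} → ¬ (a ∈ as)) → length as ≡ 0
    empty []       _  = refl
    empty (a ∷ as) ∉ = contradiction (here refl) ∉
    vanish : ∀ y → double y ≤ suc n → schur (proj₂ (term y)) e ≡ 0ℤ
    vanish y le = cong +_ (empty (semistandardFillings (twoRows (suc n ∸ double y) y) e) λ t∈ →
      sum≢ (trans (semistandard-sum (suc n ∸ double y) e y t∈) (ℕ.m∸n+n≡m le)))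

  𝓠-schurPositive : SchurPositive (𝓠 ps)
  𝓠-schurPositive with Y , n< , ≤n ← half (suc n) =
    record
      { terms     = applyUpTo term Y
      ; distinct  = subst Unique (sym (map-applyUpTo term (parts ∘ proj₂) Y))
          (Unique.applyUpTo⁺₁ (parts ∘ proj₂ ∘ term) Y λ {i} {j} i<j _ eq →
            ℕ.<⇒≢ i<j (twoRows-injective i j eq))
      ; expansion = λ e → trans (𝓠-expansion Y n< ≤n e) (sym (∑-applyUpTo term _ Y))
      } ,
    All.applyUpTo⁺₂ term Y λ b → ∑-nonneg ps _ λ p → ⟦⟧-nonneg _

-- Set partitions

module _ {A : Set} where

  Together : List (List A) → A → A → Set
  Together p e f = Any (λ B → e ∈ B × f ∈ B) p

  NonEmpty : List A → Set
  NonEmpty B = ∃ λ x → x ∈ B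

  ++-disjoint : ∀ (as : List A) {bs x} → Unique (as ++ bs) → x ∈ as → x ∉ bs
  ++-disjoint (a ∷ as) (a∉ ∷ _)  (here refl) x∈bs = All.lookup a∉ (∈-++⁺ʳ as x∈bs) refl
  ++-disjoint (a ∷ as) (_ ∷ as!) (there x∈)  x∈bs = ++-disjoint as as! x∈ x∈bs

  ++-uniqueˡ : ∀ (as : List A) {bs} → Unique (as ++ bs) → Unique as
  ++-uniqueˡ []       _          = []
  ++-uniqueˡ (a ∷ as) (a∉ ∷ as!) = All.++⁻ˡ as a∉ ∷ ++-uniqueˡ as as!

  ++-uniqueʳ : ∀ (as : List A) {bs} → Unique (as ++ bs) → Unique bs
  ++-uniqueʳ []       bs!       = bs!
  ++-uniqueʳ (a ∷ as) (_ ∷ as!) = ++-uniqueʳ as as!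

  together-sym : ∀ {p e f} → Together p e f → Together p f e
  together-sym = Any.map λ (e∈ , f∈) → f∈ , e∈

  together-∈ : ∀ {p e f} → Together p e f → e ∈ concat p
  together-∈ {B ∷ p} (here (e∈ , _)) = ∈-++⁺ˡ e∈
  together-∈ {B ∷ p} (there t)       = ∈-++⁺ʳ B (together-∈ t)

  together-refl : ∀ {p e} → e ∈ concat p → Together p e e
  together-refl {B ∷ p} e∈ with ∈-++⁻ B e∈
  ... | inj₁ e∈B = here (e∈B , e∈B)
  ... | inj₂ e∈p = there (together-refl e∈p)

  together-trans : ∀ {p e f g} → Unique (concat p) → Together p e f → Together p f g → Together p e g
  together-trans         p! (here (e∈ , _))  (here (_ , g∈))  = here (e∈ , g∈)
  together-trans {B ∷ p} p! (here (_ , f∈))  (there t)        = contradiction (together-∈ t) (++-disjoint B p! f∈)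
  together-trans {B ∷ p} p! (there t)        (here (f∈ , _))  =
    contradiction (together-∈ (together-sym t)) (++-disjoint B p! f∈)
  together-trans {B ∷ p} p! (there t)        (there t′)       = there (together-trans (++-uniqueʳ B p!) t t′)

  singleton-together : ∀ {p e f} → Unique (concat p) → [ e ] ∈ p → Together p e f → f ≡ e
  singleton-together         p! (here refl)  (here (_ , here refl)) = refl
  singleton-together {B ∷ p} p! (here refl)  (there t)              =
    contradiction (together-∈ t) (++-disjoint B p! (here refl))
  singleton-together {B ∷ p} p! (there [e]∈) (here (e∈ , _))        =
    contradiction (together-∈ (Any.map (λ { refl → here refl , here refl }) [e]∈)) (++-disjoint B p! e∈)
  singleton-together {B ∷ p} p! (there [e]∈) (there t)              = singleton-together (++-uniqueʳ B p!) [e]∈ t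

  together-singleton : ∀ {p e} → Unique (concat p) → e ∈ concat p → (∀ f → Together p e f → f ≡ e) → [ e ] ∈ p
  together-singleton {B ∷ p} {e} p! e∈ alone with ∈-++⁻ B e∈
  ... | inj₂ e∈p = there (together-singleton (++-uniqueʳ B p!) e∈p λ f → alone f ∘ there)
  ... | inj₁ e∈B = here (sym (only B e∈B (++-uniqueˡ B p!) λ f f∈ → alone f (here (e∈B , f∈))))
    where
    only : ∀ B → e ∈ B → Unique B → (∀ f → f ∈ B → f ≡ e) → B ≡ [ e ]
    only (x ∷ [])    _ _                    all-e = cong [_] (all-e x (here refl))
    only (x ∷ y ∷ B) _ ((x≢y ∷ _) ∷ _) all-e =
      contradiction (trans (all-e x (here refl)) (sym (all-e y (there (here refl))))) x≢y

  data Joins (a : A) : List (List A) → List (List A) → Set where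
    here  : ∀ {B p}           → Joins a (B ∷ p) ((a ∷ B) ∷ p)
    there : ∀ {B p q} → Joins a p q → Joins a (B ∷ p) (B ∷ q)

  ∈-joins⁻ : ∀ {a p q} → q ∈ joins a p → Joins a p q
  ∈-joins⁻ {p = B ∷ p} (here refl) = here
  ∈-joins⁻ {p = B ∷ p} (there q∈) with _ , q′∈ , refl ← ∈-map⁻ (B ∷_) q∈ = there (∈-joins⁻ q′∈)

  ∈-joins⁺ : ∀ {a p q} → Joins a p q → q ∈ joins a p
  ∈-joins⁺ here            = here refl
  ∈-joins⁺ (there {B} j) = there (∈-map⁺ (B ∷_) (∈-joins⁺ j))

  data Extends (a : A) (p : List (List A)) : List (List A) → Set where
    alone  : Extends a p ([ a ] ∷ p)
    joined : ∀ {q} → Joins a p q → Extends a p q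

  ∈-setPartitions⁻ : ∀ a as {q} → q ∈ setPartitions (a ∷ as) → ∃ λ p → p ∈ setPartitions as × Extends a p q
  ∈-setPartitions⁻ a as q∈
    with find (∈-concatMap⁻ (λ p → ([ a ] ∷ p) ∷ joins a p) {xs = setPartitions as} q∈)
  ... | p , p∈ , here refl = p , p∈ , alone
  ... | p , p∈ , there q∈  = p , p∈ , joined (∈-joins⁻ q∈)

  ∈-setPartitions⁺ : ∀ a as {p q} → p ∈ setPartitions as → Extends a p q → q ∈ setPartitions (a ∷ as)
  ∈-setPartitions⁺ a as p∈ ext = ∈-concatMap⁺ (λ p → ([ a ] ∷ p) ∷ joins a p) (lose p∈ (extension ext))
    where
    extension : ∀ {p q} → Extends a p q → q ∈ ([ a ] ∷ p) ∷ joins a p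
    extension alone      = here refl
    extension (joined j) = there (∈-joins⁺ j)

  joins-↭ : ∀ {a p q} → Joins a p q → concat q ↭ a ∷ concat p
  joins-↭         here            = Perm.refl
  joins-↭ {a} (there {B} {p} j) = Perm.trans (++⁺ˡ B (joins-↭ j)) (shift a B (concat p))

  extends-↭ : ∀ {a p q} → Extends a p q → concat q ↭ a ∷ concat p
  extends-↭ alone      = Perm.refl
  extends-↭ (joined j) = joins-↭ j

  extends-nonEmpty : ∀ {a p q} → Extends a p q → All NonEmpty p → All NonEmpty q
  extends-nonEmpty {a} alone                 ne       = (a , here refl) ∷ ne
  extends-nonEmpty {a} (joined here)         (_ ∷ ne) = (a , here refl) ∷ ne
  extends-nonEmpty     (joined (there j))    (b ∷ ne) = b ∷ extends-nonEmpty (joined j) ne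

  setPartitions-↭ : ∀ as {p} → p ∈ setPartitions as → concat p ↭ as
  setPartitions-↭ []       (here refl) = Perm.refl
  setPartitions-↭ (a ∷ as) q∈ with p , p∈ , ext ← ∈-setPartitions⁻ a as q∈ =
    Perm.trans (extends-↭ ext) (Perm.prep a (setPartitions-↭ as p∈))

  setPartitions-nonEmpty : ∀ as {p} → p ∈ setPartitions as → All NonEmpty p
  setPartitions-nonEmpty []       (here refl) = []
  setPartitions-nonEmpty (a ∷ as) q∈ with p , p∈ , ext ← ∈-setPartitions⁻ a as q∈ =
    extends-nonEmpty ext (setPartitions-nonEmpty as p∈)

  unique-resp-↭ : ∀ {as bs : List A} → as ↭ bs → Unique as → Unique bs
  unique-resp-↭ as↭bs = Setoid↭.Unique-resp-↭ (setoid A) (Perm.↭⇒↭ₛ as↭bs)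

  setPartitions-disjoint : ∀ as {p} → Unique as → p ∈ setPartitions as → Unique (concat p)
  setPartitions-disjoint as as! p∈ = unique-resp-↭ (↭-sym (setPartitions-↭ as p∈)) as!

  setPartitions-∈⁺ : ∀ as {p x} → p ∈ setPartitions as → x ∈ as → x ∈ concat p
  setPartitions-∈⁺ as p∈ = ∈-resp-↭ (↭-sym (setPartitions-↭ as p∈))

  setPartitions-∈⁻ : ∀ as {p x} → p ∈ setPartitions as → x ∈ concat p → x ∈ as
  setPartitions-∈⁻ as p∈ = ∈-resp-↭ (setPartitions-↭ as p∈)

  extends-together⁺ : ∀ {a p q e f} → Extends a p q → Together p e f → Together q e f
  extends-together⁺ alone              t               = there t
  extends-together⁺ (joined here)      (here (e∈ , f∈)) = here (there e∈ , there f∈)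
  extends-together⁺ (joined here)      (there t)       = there t
  extends-together⁺ (joined (there j)) (here t)        = here t
  extends-together⁺ (joined (there j)) (there t)       = there (extends-together⁺ (joined j) t)

  extends-together⁻ : ∀ {a p q e f} → Extends a p q → e ≢ a → f ≢ a → Together q e f → Together p e f
  extends-together⁻ alone              e≢ f≢ (here (here e≡ , _))             = contradiction e≡ e≢
  extends-together⁻ alone              e≢ f≢ (there t)                        = t
  extends-together⁻ (joined here)      e≢ f≢ (here (here e≡ , _))             = contradiction e≡ e≢
  extends-together⁻ (joined here)      e≢ f≢ (here (there _ , here f≡))       = contradiction f≡ f≢
  extends-together⁻ (joined here)      e≢ f≢ (here (there e∈ , there f∈))     = here (e∈ , f∈)
  extends-together⁻ (joined here)      e≢ f≢ (there t)                        = there t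
  extends-together⁻ (joined (there j)) e≢ f≢ (here t)                         = here t
  extends-together⁻ (joined (there j)) e≢ f≢ (there t)                        =
    there (extends-together⁻ (joined j) e≢ f≢ t)

  joins-partner : ∀ {a p q} → All NonEmpty p → Joins a p q → ∃ λ b → b ∈ concat p × Together q a b
  joins-partner ((b , b∈) ∷ _) here            = b , ∈-++⁺ˡ b∈ , here (here refl , there b∈)
  joins-partner (_ ∷ ne)       (there {B} j) with b , b∈ , t ← joins-partner ne j =
    b , ∈-++⁺ʳ B b∈ , there t

  joinBlockOf : ∀ {a p b} → b ∈ concat p → ∃ λ q → Joins a p q × Together q a b
  joinBlockOf {a} {B ∷ p} b∈ with ∈-++⁻ B b∈
  ... | inj₁ b∈B = _ , here , here (here refl , there b∈B)
  ... | inj₂ b∈p with q , j , t ← joinBlockOf {a} b∈p = B ∷ q , there j , there t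

  -- `a` has joined a nonempty block, and any old element of that block reveals which one it is.
  joins-unique : ∀ {a p q q′} → Unique (a ∷ concat p) → All NonEmpty p → Joins a p q → Joins a p q′ →
    (∀ b → Together q a b → Together q′ a b) → q ≡ q′
  joins-unique {p = B ∷ p} ap! ne here here _ = refl
  joins-unique {p = B ∷ p} (a∉ ∷ p!) ((b , b∈B) ∷ ne) here (there j) same with same b (here (here refl , there b∈B))
  ... | here (a∈B , _) = contradiction refl (All.lookup a∉ (∈-++⁺ˡ a∈B))
  ... | there t with ∈-resp-↭ (joins-↭ j) (together-∈ (together-sym t))
  ...   | here refl = contradiction refl (All.lookup a∉ (∈-++⁺ˡ b∈B))
  ...   | there b∈p = contradiction b∈p (++-disjoint B p! b∈B)
  joins-unique {p = B ∷ p} (a∉ ∷ p!) (_ ∷ ne) (there j) here same with b , b∈p , t ← joins-partner ne j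
    with same b (there t)
  ... | there t′ = contradiction refl (All.lookup a∉ (∈-++⁺ʳ B (together-∈ t′)))
  ... | here (_ , here refl) = contradiction refl (All.lookup a∉ (∈-++⁺ʳ B b∈p))
  ... | here (_ , there b∈B) = contradiction b∈p (++-disjoint B p! b∈B)
  joins-unique {p = B ∷ p} (a∉ ∷ p!) (_ ∷ ne) (there j) (there j′) same =
    cong (B ∷_) (joins-unique (All.++⁻ʳ B a∉ ∷ ++-uniqueʳ B p!) ne j j′ λ b t → case same b (there t) of λ
      { (here (a∈B , _)) → contradiction refl (All.lookup a∉ (∈-++⁺ˡ a∈B))
      ; (there t′)       → t′ })

  extends-unique : ∀ {a p q q′} → Unique (a ∷ concat p) → All NonEmpty p → Extends a p q → Extends a p q′ →
    (∀ b → Together q a b → Together q′ a b) → (∀ b → Together q′ a b → Together q a b) → q ≡ q′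
  extends-unique ap!       ne alone      alone       _    _    = refl
  extends-unique ap!       ne (joined j) (joined j′) same _    = joins-unique ap! ne j j′ same
  extends-unique (a∉ ∷ p!) ne alone      (joined j′) _    back with b , b∈ , t ← joins-partner ne j′ =
    contradiction (singleton-together (a∉ ∷ p!) (here refl) (back b t)) (≢-sym (All.lookup a∉ b∈))
  extends-unique (a∉ ∷ p!) ne (joined j) alone       same _    with b , b∈ , t ← joins-partner ne j =
    contradiction (singleton-together (a∉ ∷ p!) (here refl) (same b t)) (≢-sym (All.lookup a∉ b∈))

  fresh-unique : ∀ {a} as {p} → Unique (a ∷ as) → p ∈ setPartitions as → Unique (a ∷ concat p)
  fresh-unique as (a∉ ∷ as!) p∈ =
    All.tabulate (λ x∈ → All.lookup a∉ (setPartitions-∈⁻ as p∈ x∈)) ∷ setPartitions-disjoint as as! p∈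

  together-fresh : ∀ {a} as {p e f} → Unique (a ∷ as) → p ∈ setPartitions as → Together p e f → e ≢ a
  together-fresh as (a∉ ∷ _) p∈ t refl = All.lookup a∉ (setPartitions-∈⁻ as p∈ (together-∈ t)) refl

  extends-restrict : ∀ {a} as {p p′ q q′} → Unique (a ∷ as) → p ∈ setPartitions as → Extends a p q → Extends a p′ q′ →
    (∀ {e f} → Together q e f → Together q′ e f) → ∀ {e f} → Together p e f → Together p′ e f
  extends-restrict as as! p∈ ext ext′ q⇒q′ t = extends-together⁻ ext′ (together-fresh as as! p∈ t)
    (together-fresh as as! p∈ (together-sym t)) (q⇒q′ (extends-together⁺ ext t))

  -- The blocks of a listed partition come in one fixed order, so the relation leaves no freedom: it
  -- determines the restriction to the tail of the list, and then the block of the first element.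
  together-determines : ∀ as {p q} → Unique as → p ∈ setPartitions as → q ∈ setPartitions as →
    (∀ {e f} → Together p e f → Together q e f) → (∀ {e f} → Together q e f → Together p e f) → p ≡ q
  together-determines []       _             (here refl) (here refl) _   _   = refl
  together-determines (a ∷ as) (a∉ ∷ as!) p∈ q∈ p⇒q q⇒p
    with p′ , p′∈ , extp ← ∈-setPartitions⁻ a as p∈ | q′ , q′∈ , extq ← ∈-setPartitions⁻ a as q∈
    with refl ← together-determines as as! p′∈ q′∈
      (extends-restrict as (a∉ ∷ as!) p′∈ extp extq p⇒q) (extends-restrict as (a∉ ∷ as!) q′∈ extq extp q⇒p)
    = extends-unique (fresh-unique as (a∉ ∷ as!) p′∈) (setPartitions-nonEmpty as p′∈) extp extq (λ _ → p⇒q) (λ _ → q⇒p)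

  joins-list-unique : ∀ {a} p → Unique (joins a p)
  joins-list-unique []      = []
  joins-list-unique (B ∷ p) =
    All.tabulate (λ q∈ → λ { refl → case ∈-map⁻ (B ∷_) q∈ of λ { (_ , _ , eq) → ∷≢ (∷-injectiveˡ eq) } }) ∷
    Unique.map⁺ ∷-injectiveʳ (joins-list-unique p)
    where
    ∷≢ : ∀ {a : A} {B} → a ∷ B ≢ B
    ∷≢ {B = B} eq = ℕ.1+n≢n (cong length eq)

  -- Extensions of different partitions of `as` differ, because an extension restricts to the
  -- partition it came from.
  setPartitions-unique : ∀ as → Unique as → Unique (setPartitions as)
  setPartitions-unique []       _          = [] ∷ []
  setPartitions-unique (a ∷ as) (a∉ ∷ as!) =
    extensions-unique (setPartitions as) (setPartitions-unique as as!) λ p∈ → p∈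
    where
    ext : List (List A) → List (List (List A))
    ext p = ([ a ] ∷ p) ∷ joins a p

    ext-unique : ∀ {p} → p ∈ setPartitions as → Unique (ext p)
    ext-unique {p} p∈ = All.tabulate (λ q∈ eq → new (fresh-unique as (a∉ ∷ as!) p∈) (setPartitions-nonEmpty as p∈)
        (subst (Joins a p) (sym eq) (∈-joins⁻ q∈))) ∷ joins-list-unique p
      where
      new : ∀ {p} → Unique (a ∷ concat p) → All NonEmpty p → ¬ Joins a p ([ a ] ∷ p)
      new ap! ne j with b , b∈ , t ← joins-partner ne j =
        contradiction (singleton-together ap! (here refl) t)
          λ { refl → case ap! of λ { (a∉p ∷ _) → All.lookup a∉p b∈ refl } }

    ∈-ext : ∀ {p q} → q ∈ ext p → Extends a p q
    ∈-ext (here refl) = alone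
    ∈-ext (there q∈)  = joined (∈-joins⁻ q∈)

    origin : ∀ {p p′ q} → p ∈ setPartitions as → p′ ∈ setPartitions as → q ∈ ext p → q ∈ ext p′ → p ≡ p′
    origin p∈ p′∈ q∈ q∈′ = together-determines as as! p∈ p′∈
      (extends-restrict as (a∉ ∷ as!) p∈ (∈-ext q∈) (∈-ext q∈′) λ t → t)
      (extends-restrict as (a∉ ∷ as!) p′∈ (∈-ext q∈′) (∈-ext q∈) λ t → t)

    extensions-unique : ∀ ps → Unique ps → ps ⊆ setPartitions as → Unique (concatMap ext ps)
    extensions-unique []       _         _   = []
    extensions-unique (p ∷ ps) (p∉ ∷ ps!) ps⊆ = Unique.++⁺ (ext-unique (ps⊆ (here refl)))
      (extensions-unique ps ps! (ps⊆ ∘ there)) λ (q∈ , q∈ps) →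
        case find (∈-concatMap⁻ ext {xs = ps} q∈ps) of λ { (p′ , p′∈ , q∈′) →
          All.lookup p∉ p′∈ (origin (ps⊆ (here refl)) (ps⊆ (there p′∈)) q∈ q∈′) }

  -- The partition into the fibres of `κ`. Later partitions are constructed by giving labels, which
  -- avoids arranging blocks by hand in the fixed order of `setPartitions`.
  classify : (κ : A → ℕ) → ∀ {as} → Unique as → ∃ λ p → p ∈ setPartitions as ×
    (∀ {e f} → Together p e f → κ e ≡ κ f) × (∀ {e f} → e ∈ as → f ∈ as → κ e ≡ κ f → Together p e f)
  classify κ {[]}     _          = [] , here refl , (λ ()) , λ ()
  classify κ {a ∷ as} (a∉ ∷ as!) with p , p∈ , sound , complete ← classify κ as!
    with Any.any? (λ b → κ a ℕ.≟ κ b) as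
  ... | no ¬b = [ a ] ∷ p , ∈-setPartitions⁺ a as p∈ alone , sound′ , complete′
    where
    sound′ : ∀ {e f} → Together ([ a ] ∷ p) e f → κ e ≡ κ f
    sound′ (here (here refl , here refl)) = refl
    sound′ (there t)                      = sound t
    complete′ : ∀ {e f} → e ∈ a ∷ as → f ∈ a ∷ as → κ e ≡ κ f → Together ([ a ] ∷ p) e f
    complete′ (here refl) (here refl) _  = here (here refl , here refl)
    complete′ (here refl) (there f∈)  eq = contradiction (lose f∈ eq) ¬b
    complete′ (there e∈)  (here refl) eq = contradiction (lose e∈ (sym eq)) ¬b
    complete′ (there e∈)  (there f∈)  eq = there (complete e∈ f∈ eq)
  ... | yes any with b , b∈ , κa≡κb ← find any with q , j , t ← joinBlockOf {a} (setPartitions-∈⁺ as p∈ b∈) =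
    q , q∈ , sound′ , complete′
    where
    q∈ : q ∈ setPartitions (a ∷ as)
    q∈ = ∈-setPartitions⁺ a as p∈ (joined j)
    q! : Unique (concat q)
    q! = setPartitions-disjoint (a ∷ as) (a∉ ∷ as!) q∈
    old : ∀ {x} → x ∈ as → x ≢ a
    old x∈ refl = All.lookup a∉ x∈ refl
    with-a : ∀ {f} → f ∈ as → Together q a f → κ a ≡ κ f
    with-a f∈ t′ = trans κa≡κb (sound (extends-together⁻ (joined j) (old b∈) (old f∈)
      (together-trans q! (together-sym t) t′)))
    a-with : ∀ {f} → f ∈ as → κ a ≡ κ f → Together q a f
    a-with f∈ eq = together-trans q! t (extends-together⁺ (joined j) (complete b∈ f∈ (trans (sym κa≡κb) eq)))
    sound′ : ∀ {e f} → Together q e f → κ e ≡ κ f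
    sound′ t′ with setPartitions-∈⁻ (a ∷ as) q∈ (together-∈ t′)
                 | setPartitions-∈⁻ (a ∷ as) q∈ (together-∈ (together-sym t′))
    ... | here refl | here refl = refl
    ... | here refl | there f∈  = with-a f∈ t′
    ... | there e∈  | here refl = sym (with-a e∈ (together-sym t′))
    ... | there e∈  | there f∈  = sound (extends-together⁻ (joined j) (old e∈) (old f∈) t′)
    complete′ : ∀ {e f} → e ∈ a ∷ as → f ∈ a ∷ as → κ e ≡ κ f → Together q e f
    complete′ (here refl) (here refl) _  = together-trans q! t (together-sym t)
    complete′ (here refl) (there f∈)  eq = a-with f∈ eq
    complete′ (there e∈)  (here refl) eq = together-sym (a-with e∈ (sym eq))
    complete′ (there e∈)  (there f∈)  eq = extends-together⁺ (joined j) (complete e∈ f∈ eq)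

  -- One element is chosen from each block, so that numbers of blocks can be compared by injections.
  representatives : ∀ {p} → Unique (concat p) → All NonEmpty p → ∃ λ rs →
    length rs ≡ length p × Unique rs × rs ⊆ concat p ×
    (∀ {x y} → x ∈ rs → y ∈ rs → Together p x y → x ≡ y)
  representatives {[]}    _  []              = [] , refl , [] , (λ ()) , λ ()
  representatives {B ∷ p} p! ((b , b∈) ∷ ne) with rs , len , rs! , rs⊆ , sep ← representatives (++-uniqueʳ B p!) ne =
    b ∷ rs , cong suc len ,
    All.tabulate (λ { x∈ refl → ++-disjoint B p! b∈ (rs⊆ x∈) }) ∷ rs! ,
    (λ { (here refl) → ∈-++⁺ˡ b∈ ; (there x∈) → ∈-++⁺ʳ B (rs⊆ x∈) }) , sep′
    where
    sep′ : ∀ {x y} → x ∈ b ∷ rs → y ∈ b ∷ rs → Together (B ∷ p) x y → x ≡ y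
    sep′ (here refl) (here refl) _               = refl
    sep′ (here refl) (there y∈)  (here (_ , y∈B)) = contradiction (rs⊆ y∈) (++-disjoint B p! y∈B)
    sep′ (here refl) (there y∈)  (there t)       = contradiction (together-∈ t) (++-disjoint B p! b∈)
    sep′ (there x∈)  (here refl) (here (x∈B , _)) = contradiction (rs⊆ x∈) (++-disjoint B p! x∈B)
    sep′ (there x∈)  (here refl) (there t)       = contradiction (together-∈ (together-sym t)) (++-disjoint B p! b∈)
    sep′ (there x∈)  (there y∈)  (here (x∈B , _)) = contradiction (rs⊆ x∈) (++-disjoint B p! x∈B)
    sep′ (there x∈)  (there y∈)  (there t)       = sep x∈ y∈ t

-- Numbering the blocks of a partition

module _ {A : Set} (_≟_ : DecidableEquality A) where

  open DecMembership _≟_ using (_∈?_)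

  blockIndex : List (List A) → A → ℕ
  blockIndex []      e = 0
  blockIndex (B ∷ p) e with e ∈? B
  ... | yes _ = 0
  ... | no  _ = suc (blockIndex p e)

  blockIndex-< : ∀ p {e} → e ∈ concat p → blockIndex p e < length p
  blockIndex-< (B ∷ p) {e} e∈ with e ∈? B
  ... | yes _  = s≤s z≤n
  ... | no  e∉ with ∈-++⁻ B e∈
  ...   | inj₁ e∈B = contradiction e∈B e∉
  ...   | inj₂ e∈p = s≤s (blockIndex-< p e∈p)

  together⇒blockIndex : ∀ {p e f} → Unique (concat p) → Together p e f → blockIndex p e ≡ blockIndex p f
  together⇒blockIndex {B ∷ p} {e} {f} p! (here (e∈ , f∈)) with e ∈? B | f ∈? B
  ... | yes _ | yes _ = refl
  ... | no e∉ | _     = contradiction e∈ e∉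
  ... | _     | no f∉ = contradiction f∈ f∉
  together⇒blockIndex {B ∷ p} {e} {f} p! (there t) with e ∈? B | f ∈? B
  ... | yes e∈ | _      = contradiction (together-∈ t) (++-disjoint B p! e∈)
  ... | no _   | yes f∈ = contradiction (together-∈ (together-sym t)) (++-disjoint B p! f∈)
  ... | no _   | no _   = cong suc (together⇒blockIndex (++-uniqueʳ B p!) t)

  blockIndex⇒together : ∀ p {e f} → e ∈ concat p → blockIndex p e ≡ blockIndex p f → Together p e f
  blockIndex⇒together (B ∷ p) {e} {f} e∈ eq with e ∈? B | f ∈? B
  ... | yes e∈B | yes f∈B = here (e∈B , f∈B)
  ... | no e∉   | no _ with ∈-++⁻ B e∈
  ...   | inj₁ e∈B = contradiction e∈B e∉
  ...   | inj₂ e∈p = there (blockIndex⇒together p e∈p (ℕ.suc-injective eq))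

  -- `h` sends representatives of the blocks of `q` into different blocks of `p`, so the index of
  -- the block of the image is injective on them.
  length-monotone : ∀ {B : Set} (h : B → A) {p q} → Unique (concat q) → All NonEmpty q →
    (∀ {x} → x ∈ concat q → h x ∈ concat p) →
    (∀ {x y} → Together p (h x) (h y) → x ∈ concat q → y ∈ concat q → Together q x y) →
    length q ≤ length p
  length-monotone h {p} {q} q! ne h∈ reflects with rs , len , rs! , rs⊆ , sep ← representatives q! ne =
    subst₂ _≤_ len (length-upTo (length p)) (length-injection (blockIndex p ∘ h)
      (λ x∈ y∈ eq → sep x∈ y∈ (reflects (blockIndex⇒together p (h∈ (rs⊆ x∈)) eq) (rs⊆ x∈) (rs⊆ y∈)))
      rs! λ x∈ → ∈-upTo⁺ (blockIndex-< p (h∈ (rs⊆ x∈))))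

-- Edges of the complete graph and pullbacks of their partitions

edges-unique : ∀ n → Unique (edges n)
edges-unique n = Unique.filter⁺ (λ (i , j) → i <?ᶠ j) (Unique.cartesianProduct⁺ (Unique.allFin⁺ n) (Unique.allFin⁺ n))

∈-edges⁺ : {a b : Fin n} → a <ᶠ b → (a , b) ∈ edges n
∈-edges⁺ a<b = ∈-filter⁺ (λ (i , j) → i <?ᶠ j) (∈-cartesianProduct⁺ (∈-allFin _) (∈-allFin _)) a<b

∈-edges⁻ : {a b : Fin n} → (a , b) ∈ edges n → a <ᶠ b
∈-edges⁻ {n} e∈ = proj₂ (∈-filter⁻ (λ (i , j) → i <?ᶠ j) {xs = cartesianProduct (allFin n) (allFin n)} e∈)

edgeOf-< : {a b : Fin n} → a <ᶠ b → edgeOf (a , b) ≡ (a , b)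
edgeOf-< {a = a} {b} a<b with a <?ᶠ b
... | yes _  = refl
... | no a≮b = contradiction a<b a≮b

edgeOf-> : {a b : Fin n} → b <ᶠ a → edgeOf (a , b) ≡ (b , a)
edgeOf-> {a = a} {b} b<a with a <?ᶠ b
... | yes a<b = contradiction a<b (Fin.<-asym b<a)
... | no _    = refl

edgeOf-inverse : ∀ (a b : Fin n) {x y} → (x , y) ≡ edgeOf (a , b) → (x ≡ a × y ≡ b) ⊎ (x ≡ b × y ≡ a)
edgeOf-inverse a b eq with a <?ᶠ b
... | yes _ = inj₁ (,-injective eq)
... | no _  = inj₂ (,-injective eq)

edgeOf-∈ : {a b : Fin n} → a ≢ b → edgeOf (a , b) ∈ edges n
edgeOf-∈ {a = a} {b} a≢b with Fin.<-cmp a b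
... | tri< a<b _ _ = subst (_∈ _) (sym (edgeOf-< a<b)) (∈-edges⁺ a<b)
... | tri≈ _ a≡b _ = contradiction a≡b a≢b
... | tri> _ _ b<a = subst (_∈ _) (sym (edgeOf-> b<a)) (∈-edges⁺ b<a)

module _ {n : ℕ} where

  IsPartition : Blocks n → Set
  IsPartition p = p ∈ setPartitions (edges n)

  IsPartition-∈ : ∀ {p e} → IsPartition p → e ∈ edges n → e ∈ concat p
  IsPartition-∈ = setPartitions-∈⁺ (edges n)

  IsPartition-disjoint : ∀ {p} → IsPartition p → Unique (concat p)
  IsPartition-disjoint = setPartitions-disjoint (edges n) (edges-unique n)

  together-edge : ∀ {p e f} → IsPartition p → Together p e f → e ∈ edges n
  together-edge p∈ t = setPartitions-∈⁻ (edges n) p∈ (together-∈ t)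

  module Pullback (h : Edge n → Edge n) where

    -- Each edge is labelled with the block of its image under `h`, so the blocks are the nonempty
    -- preimages of blocks of `p`.
    pull : Blocks n → Blocks n
    pull p = proj₁ (classify (blockIndex _≟ᴱ_ p ∘ h) (edges-unique n))

    pull-partition : ∀ p → IsPartition (pull p)
    pull-partition p = proj₁ (proj₂ (classify (blockIndex _≟ᴱ_ p ∘ h) (edges-unique n)))

    module _ (h∈ : ∀ {e} → e ∈ edges n → h e ∈ edges n) {p : Blocks n} (p∈ : IsPartition p) where

      pull⇒ : ∀ {e f} → Together (pull p) e f → Together p (h e) (h f)
      pull⇒ t = blockIndex⇒together _≟ᴱ_ p
        (IsPartition-∈ p∈ (h∈ (together-edge (pull-partition p) t)))
        (proj₁ (proj₂ (proj₂ (classify (blockIndex _≟ᴱ_ p ∘ h) (edges-unique n)))) t)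

      pull⇐ : ∀ {e f} → e ∈ edges n → f ∈ edges n → Together p (h e) (h f) → Together (pull p) e f
      pull⇐ e∈ f∈ t = proj₂ (proj₂ (proj₂ (classify (blockIndex _≟ᴱ_ p ∘ h) (edges-unique n)))) e∈ f∈
        (together⇒blockIndex _≟ᴱ_ (IsPartition-disjoint p∈) t)

      pull-length : length (pull p) ≤ length p
      pull-length = length-monotone _≟ᴱ_ h (IsPartition-disjoint (pull-partition p))
        (setPartitions-nonEmpty (edges n) (pull-partition p))
        (λ x∈ → IsPartition-∈ p∈ (h∈ (setPartitions-∈⁻ (edges n) (pull-partition p) x∈)))
        λ t x∈ y∈ → pull⇐ (setPartitions-∈⁻ (edges n) (pull-partition p) x∈)
                          (setPartitions-∈⁻ (edges n) (pull-partition p) y∈) t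

  open Pullback public

  module _ (h h′ : Edge n → Edge n)
    (h∈ : ∀ {e} → e ∈ edges n → h e ∈ edges n) (h′∈ : ∀ {e} → e ∈ edges n → h′ e ∈ edges n)
    {p : Blocks n} (p∈ : IsPartition p) (hh′ : ∀ {e} → e ∈ edges n → Together p (h (h′ e)) e) where

    -- The composite of `h′` and `h` need not be the identity: it suffices that it keeps every edge
    -- inside its block of `p`.
    pull-inverse : pull h′ (pull h p) ≡ p
    pull-inverse = together-determines (edges n) (edges-unique n) (pull-partition h′ (pull h p)) p∈
      (λ t → let e∈ = together-edge (pull-partition h′ (pull h p)) t
                 f∈ = together-edge (pull-partition h′ (pull h p)) (together-sym t) in
        together-trans (IsPartition-disjoint p∈) (together-sym (hh′ e∈)) (together-trans (IsPartition-disjoint p∈)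
          (pull⇒ h h∈ p∈ (pull⇒ h′ h′∈ (pull-partition h p) t)) (hh′ f∈)))
      λ t → let e∈ = together-edge p∈ t
                f∈ = together-edge p∈ (together-sym t) in
        pull⇐ h′ h′∈ (pull-partition h p) e∈ f∈ (pull⇐ h h∈ p∈ (h′∈ e∈) (h′∈ f∈)
          (together-trans (IsPartition-disjoint p∈) (hh′ e∈) (together-trans (IsPartition-disjoint p∈) t
            (together-sym (hh′ f∈)))))

    -- A pullback never has more blocks than the original, and here a second pullback leads back.
    pull-length-≡ : length (pull h p) ≡ length p
    pull-length-≡ = ℕ.≤-antisym (pull-length h h∈ p∈)
      (subst (_≤ length (pull h p)) (cong length pull-inverse) (pull-length h′ h′∈ (pull-partition h p)))

-- The condition on triangles; the first alternative is available for Gallai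
-- partitions (Allow = ⊤) but not for transitive ones (Allow = ⊥).
Triangles : Set → Blocks n → Set
Triangles Allow p = ∀ {a b c} → a <ᶠ b → b <ᶠ c →
  (Allow × Together p (a , b) (b , c)) ⊎ Together p (a , b) (a , c) ⊎ Together p (b , c) (a , c)

-- No vertex lies strictly between m and c.
Adjacent : Fin n → Fin n → Set
Adjacent m c = ∀ {v} → v ≢ m → v ≢ c → (v <ᶠ m → v <ᶠ c) × (m <ᶠ v → c <ᶠ v)

Adjacent-suc : {m c : Fin n} → toℕ c ≡ suc (toℕ m) → Adjacent m c
Adjacent-suc {m = m} {c} eq {v} v≢m v≢c =
  (λ v<m → subst (toℕ v <_) (sym eq) (ℕ.m<n⇒m<1+n v<m)) ,
  λ m<v → ℕ.≤∧≢⇒< (subst (_≤ toℕ v) (sym eq) m<v) (≢-sym v≢c ∘ Fin.toℕ-injective)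

Adjacent-pred : {m c : Fin n} → toℕ m ≡ suc (toℕ c) → Adjacent m c
Adjacent-pred {m = m} {c} eq {v} v≢m v≢c =
  (λ v<m → ℕ.≤∧≢⇒< (ℕ.≤-pred (subst (toℕ v <_) eq v<m)) (v≢c ∘ Fin.toℕ-injective)) ,
  λ m<v → ℕ.≤-trans (ℕ.≤-reflexive (sym eq)) (ℕ.<⇒≤ m<v)

-- Twin vertices

module _ {Allow : Set} {p : Blocks n} (p∈ : IsPartition p) (△ : Triangles Allow p) where

  private
    p! : Unique (concat p)
    p! = IsPartition-disjoint p∈

  -- A singleton edge cannot belong to the repeated pair of the triangle, so the other two edges
  -- form that pair.
  twins-above : ∀ {x y v} → [ (x , y) ] ∈ p → x <ᶠ y → y <ᶠ v → Together p (x , v) (y , v)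
  twins-above xy∈ x<y y<v with △ x<y y<v
  ... | inj₁ (_ , t)    = contradiction (,-injectiveˡ (singleton-together p! xy∈ t)) (≢-sym (Fin.<⇒≢ x<y))
  ... | inj₂ (inj₁ t)   = contradiction (,-injectiveʳ (singleton-together p! xy∈ t)) (≢-sym (Fin.<⇒≢ y<v))
  ... | inj₂ (inj₂ t)   = together-sym t

  twins-below : ∀ {x y v} → [ (x , y) ] ∈ p → v <ᶠ x → x <ᶠ y → Together p (v , x) (v , y)
  twins-below xy∈ v<x x<y with △ v<x x<y
  ... | inj₁ (_ , t)    = contradiction (,-injectiveˡ (singleton-together p! xy∈ (together-sym t))) (Fin.<⇒≢ v<x)
  ... | inj₂ (inj₁ t)   = t
  ... | inj₂ (inj₂ t)   = contradiction (,-injectiveˡ (singleton-together p! xy∈ t)) (Fin.<⇒≢ v<x)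

  -- The first singleton makes `a` and `b` twins, which puts (a , c) into the block of (b , c).
  no-consecutive-singletons : ∀ {a b c} → a <ᶠ b → b <ᶠ c → [ (a , b) ] ∈ p → ¬ [ (b , c) ] ∈ p
  no-consecutive-singletons a<b b<c ab∈ bc∈ =
    contradiction (,-injectiveˡ (singleton-together p! bc∈ (together-sym (twins-above ab∈ a<b b<c)))) (Fin.<⇒≢ a<b)

-- Collapsing m onto c, and moving the edge that disappears to {m , d}
module Collapse {n : ℕ} {m c d : Fin n} (m≢c : m ≢ c) (m≢d : m ≢ d)
                (m~c : Adjacent m c) where

  collapse : Fin n → Fin n
  collapse v with v Fin.≟ m
  ... | yes _ = c
  ... | no _  = v

  collapse-m : collapse m ≡ c
  collapse-m with m Fin.≟ m
  ... | yes _  = refl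
  ... | no m≢m = contradiction refl m≢m

  collapse-other : ∀ {v} → v ≢ m → collapse v ≡ v
  collapse-other {v} v≢m with v Fin.≟ m
  ... | yes v≡m = contradiction v≡m v≢m
  ... | no _    = refl

  collapse-≢ : ∀ v → collapse v ≢ m
  collapse-≢ v with v Fin.≟ m
  ... | yes _  = ≢-sym m≢c
  ... | no v≢m = v≢m

  -- Pulling back makes `m` a copy of `c`: an edge from `m` takes the block of the corresponding
  -- edge from `c`. Only {m , c} has no counterpart; it takes the block of {m , d}, which is a
  -- singleton in the application. Thus one singleton block is traded for another.
  moveEdge : Edge n → Edge n
  moveEdge (u , v) with (u , v) ≟ᴱ edgeOf (m , c)
  ... | yes _ = edgeOf (m , d)
  ... | no _  = collapse u , collapse v

  moveEdge-mc : moveEdge (edgeOf (m , c)) ≡ edgeOf (m , d)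
  moveEdge-mc with edgeOf (m , c) ≟ᴱ edgeOf (m , c)
  ... | yes _  = refl
  ... | no neq = contradiction refl neq

  moveEdge-other : ∀ {u v} → (u , v) ≢ edgeOf (m , c) → moveEdge (u , v) ≡ (collapse u , collapse v)
  moveEdge-other {u} {v} neq with (u , v) ≟ᴱ edgeOf (m , c)
  ... | yes eq = contradiction eq neq
  ... | no _   = refl

  -- Adjacency of `m` and `c` is what preserves the order here, and `Triangles` depends on that
  -- order.
  collapse-mono : ∀ {u v} → (u , v) ≢ edgeOf (m , c) → u <ᶠ v → collapse u <ᶠ collapse v
  collapse-mono {u} {v} neq u<v with u Fin.≟ m | v Fin.≟ m
  ... | no _     | no _     = u<v
  ... | yes refl | yes refl = contradiction u<v (Fin.<-irrefl refl)
  ... | yes refl | no v≢m   = proj₂ (m~c v≢m λ { refl → neq (sym (edgeOf-< u<v)) }) u<v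
  ... | no u≢m   | yes refl = proj₁ (m~c u≢m λ { refl → neq (sym (edgeOf-> u<v)) }) u<v

  moveEdge-∈ : ∀ {e} → e ∈ edges n → moveEdge e ∈ edges n
  moveEdge-∈ {u , v} e∈ with (u , v) ≟ᴱ edgeOf (m , c)
  ... | yes _  = edgeOf-∈ m≢d
  ... | no neq = ∈-edges⁺ (collapse-mono neq (∈-edges⁻ e∈))

  collapse-avoids : ∀ u v → (collapse u , collapse v) ≢ edgeOf (m , d)
  collapse-avoids u v eq with edgeOf-inverse m d eq
  ... | inj₁ (eq′ , _) = collapse-≢ u eq′
  ... | inj₂ (_ , eq′) = collapse-≢ v eq′

  -- All other images avoid the vertex `m`. Hence {m , c} becomes a singleton in the pullback when
  -- {m , d} is one.
  moveEdge-md⁻ : ∀ {e} → moveEdge e ≡ edgeOf (m , d) → e ≡ edgeOf (m , c)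
  moveEdge-md⁻ {u , v} eq with (u , v) ≟ᴱ edgeOf (m , c)
  ... | yes eq′ = eq′
  ... | no _    = contradiction eq (collapse-avoids u v)

  module _ {Allow : Set} {p : Blocks n} (p∈ : IsPartition p) where

    private
      q : Blocks n
      q = pull moveEdge p
      q∈ : IsPartition q
      q∈ = pull-partition moveEdge p
      lift : ∀ {e f} → e ∈ edges n → f ∈ edges n → Together p (moveEdge e) (moveEdge f) → Together q e f
      lift = pull⇐ moveEdge moveEdge-∈ p∈
      descend : ∀ {e f} → Together q e f → Together p (moveEdge e) (moveEdge f)
      descend = pull⇒ moveEdge moveEdge-∈ p∈
      same : ∀ {e f} → e ∈ edges n → f ∈ edges n → moveEdge e ≡ moveEdge f → Together q e f
      same {e} e∈ f∈ eq = lift e∈ f∈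
        (subst (Together p (moveEdge e)) eq (together-refl (IsPartition-∈ p∈ (moveEdge-∈ e∈))))

    -- A triangle without the edge {m , c} is mapped to a triangle whose vertices are in the same
    -- order. In a triangle that contains this edge, the other two edges have the same image.
    pull-triangles : Triangles Allow p → Triangles Allow q
    pull-triangles △ {a} {b} {x} a<b b<x with (a , b) ≟ᴱ edgeOf (m , c) | (b , x) ≟ᴱ edgeOf (m , c)
    ... | yes ab | _ = inj₂ (inj₂ (same (∈-edges⁺ b<x) (∈-edges⁺ a<x)
        (trans (moveEdge-other bx≢) (trans (cong (_, collapse x) (sym a≈b)) (sym (moveEdge-other ax≢))))))
      where
      a<x : a <ᶠ x
      a<x = Fin.<-trans a<b b<x
      bx≢ : (b , x) ≢ edgeOf (m , c)
      bx≢ eq = Fin.<⇒≢ a<b (,-injectiveˡ (trans ab (sym eq)))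
      ax≢ : (a , x) ≢ edgeOf (m , c)
      ax≢ eq = Fin.<⇒≢ b<x (,-injectiveʳ (trans ab (sym eq)))
      a≈b : collapse a ≡ collapse b
      a≈b with edgeOf-inverse m c ab
      ... | inj₁ (refl , refl) = trans collapse-m (sym (collapse-other (≢-sym m≢c)))
      ... | inj₂ (refl , refl) = trans (collapse-other (≢-sym m≢c)) (sym collapse-m)
    ... | no ab | yes bx = inj₂ (inj₁ (same (∈-edges⁺ a<b) (∈-edges⁺ a<x)
        (trans (moveEdge-other ab) (trans (cong (collapse a ,_) b≈x) (sym (moveEdge-other ax≢))))))
      where
      a<x : a <ᶠ x
      a<x = Fin.<-trans a<b b<x
      ax≢ : (a , x) ≢ edgeOf (m , c)
      ax≢ eq = Fin.<⇒≢ a<b (,-injectiveˡ (trans eq (sym bx)))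
      b≈x : collapse b ≡ collapse x
      b≈x with edgeOf-inverse m c bx
      ... | inj₁ (refl , refl) = trans collapse-m (sym (collapse-other (≢-sym m≢c)))
      ... | inj₂ (refl , refl) = trans (collapse-other (≢-sym m≢c)) (sym collapse-m)
    ... | no ab | no bx = case △ (collapse-mono ab a<b) (collapse-mono bx b<x) of λ
      { (inj₁ (allow , t)) → inj₁ (allow , transport ab bx (∈-edges⁺ a<b) (∈-edges⁺ b<x) t)
      ; (inj₂ (inj₁ t))    → inj₂ (inj₁ (transport ab ax (∈-edges⁺ a<b) (∈-edges⁺ a<x) t))
      ; (inj₂ (inj₂ t))    → inj₂ (inj₂ (transport bx ax (∈-edges⁺ b<x) (∈-edges⁺ a<x) t)) }
      where
      a<x : a <ᶠ x
      a<x = Fin.<-trans a<b b<x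
      -- No vertex lies strictly between `m` and `c`, so they are not the least and the greatest of
      -- three vertices.
      ax : (a , x) ≢ edgeOf (m , c)
      ax eq with edgeOf-inverse m c eq
      ... | inj₁ (refl , refl) = Fin.<-asym b<x (proj₂ (m~c (≢-sym (Fin.<⇒≢ a<b)) (Fin.<⇒≢ b<x)) a<b)
      ... | inj₂ (refl , refl) = Fin.<-asym a<b (proj₁ (m~c (Fin.<⇒≢ b<x) (≢-sym (Fin.<⇒≢ a<b))) b<x)
      transport : ∀ {u v u′ v′} → (u , v) ≢ edgeOf (m , c) → (u′ , v′) ≢ edgeOf (m , c) →
        (u , v) ∈ edges n → (u′ , v′) ∈ edges n →
        Together p (collapse u , collapse v) (collapse u′ , collapse v′) → Together q (u , v) (u′ , v′)
      transport neq neq′ e∈ f∈ t = lift e∈ f∈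
        (subst₂ (Together p) (sym (moveEdge-other neq)) (sym (moveEdge-other neq′)) t)

    pull-moved : [ edgeOf (m , d) ] ∈ p → [ edgeOf (m , c) ] ∈ q
    pull-moved md∈ = together-singleton (IsPartition-disjoint q∈) (IsPartition-∈ q∈ (edgeOf-∈ m≢c)) λ f t →
      moveEdge-md⁻ (singleton-together (IsPartition-disjoint p∈) md∈
        (subst (λ e → Together p e (moveEdge f)) moveEdge-mc (descend t)))

    pull-unmoved : ∀ {x y} → x ≢ m → y ≢ m → x ≢ c → y ≢ c → x <ᶠ y → [ (x , y) ] ∈ p → [ (x , y) ] ∈ q
    pull-unmoved {x} {y} x≢m y≢m x≢c y≢c x<y xy∈ =
      together-singleton (IsPartition-disjoint q∈) (IsPartition-∈ q∈ (∈-edges⁺ x<y)) λ f t →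
        fixed f (singleton-together (IsPartition-disjoint p∈) xy∈
          (subst (λ e → Together p e (moveEdge f))
            (trans (moveEdge-other xy≢) (cong₂ _,_ (collapse-other x≢m) (collapse-other y≢m))) (descend t)))
      where
      xy≢ : (x , y) ≢ edgeOf (m , c)
      xy≢ eq with edgeOf-inverse m c eq
      ... | inj₁ (x≡m , _) = x≢m x≡m
      ... | inj₂ (x≡c , _) = x≢c x≡c
      uncollapse : ∀ {u x} → x ≢ c → collapse u ≡ x → u ≡ x
      uncollapse {u} x≢c eq with u Fin.≟ m
      ... | yes _ = contradiction (sym eq) x≢c
      ... | no _  = eq
      fixed : ∀ f → moveEdge f ≡ (x , y) → f ≡ (x , y)
      fixed (u , v) eq with (u , v) ≟ᴱ edgeOf (m , c)
      ... | no _  = cong₂ _,_ (uncollapse x≢c (,-injectiveˡ eq)) (uncollapse y≢c (,-injectiveʳ eq))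
      ... | yes _ with edgeOf-inverse m d (sym eq)
      ...   | inj₁ (x≡m , _) = contradiction x≡m x≢m
      ...   | inj₂ (_ , y≡m) = contradiction y≡m y≢m

-- Inverting the collapse when {m , d} is a singleton

module _ {n : ℕ} {m c d : Fin n} (m≢c : m ≢ c) (m≢d : m ≢ d)
         (m~c : Adjacent m c) (m~d : Adjacent m d)
         {Allow : Set} {p : Blocks n} (p∈ : IsPartition p) (△ : Triangles Allow p)
         (md∈ : [ edgeOf (m , d) ] ∈ p) where

  private
    module C = Collapse m≢c m≢d m~c
    module D = Collapse m≢d m≢c m~d

  twins : ∀ {v} → v ≢ m → v ≢ d → (m <ᶠ v → Together p (d , v) (m , v)) × (v <ᶠ m → Together p (v , d) (v , m))
  twins {v} v≢m v≢d with Fin.<-cmp m d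
  ... | tri≈ _ m≡d _ = contradiction m≡d m≢d
  ... | tri< m<d _ _ =
    (λ m<v → together-sym (twins-above p∈ △ (subst (λ e → [ e ] ∈ p) (edgeOf-< m<d) md∈) m<d
      (proj₂ (m~d v≢m v≢d) m<v))) ,
    (λ v<m → together-sym (twins-below p∈ △ (subst (λ e → [ e ] ∈ p) (edgeOf-< m<d) md∈) v<m m<d))
  ... | tri> _ _ d<m =
    (λ m<v → twins-above p∈ △ (subst (λ e → [ e ] ∈ p) (edgeOf-> d<m) md∈) d<m m<v) ,
    (λ v<m → twins-below p∈ △ (subst (λ e → [ e ] ∈ p) (edgeOf-> d<m) md∈) (proj₁ (m~d v≢m v≢d) v<m) d<m)

  -- The composite fixes {m , d} and otherwise replaces `m` by its twin `d`, which does not leave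
  -- the block.
  moveEdge-back : ∀ {e} → e ∈ edges n → Together p (C.moveEdge (D.moveEdge e)) e
  moveEdge-back {u , v} e∈ with (u , v) ≟ᴱ edgeOf (m , d)
  ... | yes eq = subst₂ (Together p) (sym C.moveEdge-mc) (sym eq) (together-refl (IsPartition-∈ p∈ (edgeOf-∈ m≢d)))
  ... | no neq = subst (λ e → Together p e (u , v))
      (sym (trans (C.moveEdge-other (D.collapse-avoids u v))
                  (cong₂ _,_ (C.collapse-other (D.collapse-≢ u)) (C.collapse-other (D.collapse-≢ v)))))
      collapsed
    where
    u<v : u <ᶠ v
    u<v = ∈-edges⁻ e∈
    collapsed : Together p (D.collapse u , D.collapse v) (u , v)
    collapsed with u Fin.≟ m | v Fin.≟ m
    ... | no _     | no _     = together-refl (IsPartition-∈ p∈ e∈)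
    ... | yes refl | yes refl = contradiction u<v (Fin.<-irrefl refl)
    ... | yes refl | no v≢m   = proj₁ (twins v≢m λ { refl → neq (sym (edgeOf-< u<v)) }) u<v
    ... | no u≢m   | yes refl = proj₂ (twins u≢m λ { refl → neq (sym (edgeOf-> u<v)) }) u<v

  pull-back : pull D.moveEdge (pull C.moveEdge p) ≡ p
  pull-back = pull-inverse C.moveEdge D.moveEdge C.moveEdge-∈ D.moveEdge-∈ p∈ moveEdge-back

  pull-blocks : length (pull C.moveEdge p) ≡ length p
  pull-blocks = pull-length-≡ C.moveEdge D.moveEdge C.moveEdge-∈ D.moveEdge-∈ p∈ moveEdge-back

-- Descent sets and prescribed words

bit-tabulate⁺ : (f : Fin n → Bool) (i : Fin n) → bit (Vec.tabulate f) (toℕ i) ≡ f i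
bit-tabulate⁺ f zero    = refl
bit-tabulate⁺ f (suc i) = bit-tabulate⁺ (f ∘ suc) i

bit-tabulate⁻ : (f : Fin n → Bool) → ∀ j → bit (Vec.tabulate f) j ≡ true → ∃ λ i → toℕ i ≡ j × f i ≡ true
bit-tabulate⁻ {suc n} f zero    eq = zero , refl , eq
bit-tabulate⁻ {suc n} f (suc j) eq with i , i≡j , fi ← bit-tabulate⁻ (f ∘ suc) j eq = suc i , cong suc i≡j , fi

Descent : Blocks (suc n) → Fin n → Set
Descent p i = [ (inject₁ i , suc i) ] ∈ p

Des⁺ : (p : Blocks (suc n)) (i : Fin n) → Descent p i → bit (Des p) (toℕ i) ≡ true
Des⁺ p i des = trans (bit-tabulate⁺ _ i) (dec-true (_ ∈ᴮ? p) des)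
  where open DecMembership (≡-decList _≟ᴱ_) using () renaming (_∈?_ to _∈ᴮ?_)

Des⁻ : (p : Blocks (suc n)) → ∀ j → bit (Des p) j ≡ true → ∃ λ i → toℕ i ≡ j × Descent p i
Des⁻ p j eq with i , i≡j , di ← bit-tabulate⁻ _ j eq = i , i≡j , does-true di
  where
  open DecMembership (≡-decList _≟ᴱ_) using () renaming (_∈?_ to _∈ᴮ?_)
  does-true : ∀ {B} → does (B ∈ᴮ? p) ≡ true → B ∈ p
  does-true {B} eq with B ∈ᴮ? p
  ... | yes B∈ = B∈

inject₁<suc : (i : Fin n) → inject₁ i <ᶠ suc i
inject₁<suc i = ℕ.≤-reflexive (cong suc (Fin.toℕ-inject₁ i))

triangles-sparse : ∀ {Allow} {p : Blocks (suc n)} → IsPartition p → Triangles Allow p → Sparse (bit (Des p))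
triangles-sparse {p = p} p∈ △ j dj with bit (Des p) (suc j) in dsj
... | false = refl
... | true  with Des⁻ p j dj | Des⁻ p (suc j) dsj
...   | i , refl , des | suc i′ , eq , des′ = contradiction
  (subst (λ v → [ (v , suc (suc i′)) ] ∈ p)
    (cong suc (Fin.toℕ-injective (trans (Fin.toℕ-inject₁ i′) (ℕ.suc-injective eq)))) des′)
  (no-consecutive-singletons p∈ △ (inject₁<suc i) (ℕ.≤-reflexive (cong suc (sym eq))) des)

-- When no composition follows the word, `prescribed` demands descents and forbids none.
prescribed-mono : ∀ v {d d′} → (∀ j → d j ≡ true → d′ j ≡ true) → prescribed v [] d ≡ true → prescribed v [] d′ ≡ true
prescribed-mono []          d⇒d′ eq = refl
prescribed-mono (true  ∷ v) {d} {d′} d⇒d′ eq with d 0 in d₀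
... | true rewrite d⇒d′ 0 d₀ = prescribed-mono v (λ j → d⇒d′ (2 ℕ.+ j)) eq
prescribed-mono (false ∷ v) d⇒d′ eq = prescribed-mono v (λ j → d⇒d′ (suc j)) eq

-- The edge from `j` to `j + 1` meets none of `s`, `s + 1`, `s + 2`, the three vertices that take
-- part in an exchange at `s`.
Outside : ℕ → ℕ → Set
Outside s j = suc j < s ⊎ 3 ℕ.+ s ≤ j

Outside-suc : ∀ {s j} → Outside s j → Outside (suc s) (suc j)
Outside-suc (inj₁ lt) = inj₁ (s≤s lt)
Outside-suc (inj₂ le) = inj₂ (s≤s le)

prescribed-here : ∀ u v {d} → prescribed (u ++ true ∷ false ∷ v) [] d ≡ true → d (size u) ≡ true
prescribed-here []          v {d} eq with d 0
... | true = refl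
prescribed-here (true  ∷ u) v {d} eq with d 0
... | true = prescribed-here u v eq
prescribed-here (false ∷ u) v eq = prescribed-here u v eq

prescribed-next : ∀ u v {d} → prescribed (u ++ false ∷ true ∷ v) [] d ≡ true → d (suc (size u)) ≡ true
prescribed-next []          v {d} eq with d 1
... | true = refl
prescribed-next (true  ∷ u) v {d} eq with d 0
... | true = prescribed-next u v eq
prescribed-next (false ∷ u) v eq = prescribed-next u v eq

-- The trues of `u` and `v` ask for descents away from the three vertices of the exchange, so only
-- the descent between them has to be supplied anew.
prescribed-right : ∀ u v {d d′} → d′ (suc (size u)) ≡ true → (∀ j → Outside (size u) j → d j ≡ true → d′ j ≡ true) →
  prescribed (u ++ true ∷ false ∷ v) [] d ≡ true → prescribed (u ++ false ∷ true ∷ v) [] d′ ≡ true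
prescribed-right [] v {d} {d′} next out eq rewrite next with d 0
... | true = prescribed-mono v (λ j → out (3 ℕ.+ j) (inj₂ (s≤s (s≤s (s≤s z≤n))))) eq
prescribed-right (true ∷ u) v {d} next out eq with d 0 in d₀
... | true rewrite out 0 (inj₁ (s≤s (s≤s z≤n))) d₀ =
  prescribed-right u v next (λ j o → out (2 ℕ.+ j) (Outside-suc (Outside-suc o))) eq
prescribed-right (false ∷ u) v next out eq = prescribed-right u v next (λ j o → out (suc j) (Outside-suc o)) eq

prescribed-left : ∀ u v {d d′} → d′ (size u) ≡ true → (∀ j → Outside (size u) j → d j ≡ true → d′ j ≡ true) →
  prescribed (u ++ false ∷ true ∷ v) [] d ≡ true → prescribed (u ++ true ∷ false ∷ v) [] d′ ≡ true
prescribed-left [] v {d} {d′} here′ out eq rewrite here′ with d 1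
... | true = prescribed-mono v (λ j → out (3 ℕ.+ j) (inj₂ (s≤s (s≤s (s≤s z≤n))))) eq
prescribed-left (true ∷ u) v {d} here′ out eq with d 0 in d₀
... | true rewrite out 0 (inj₁ (s≤s (s≤s z≤n))) d₀ =
  prescribed-left u v here′ (λ j o → out (2 ℕ.+ j) (Outside-suc (Outside-suc o))) eq
prescribed-left (false ∷ u) v here′ out eq = prescribed-left u v here′ (λ j o → out (suc j) (Outside-suc o)) eq

∑-indicator : ∀ {A : Set} (as : List A) (P : A → Bool) → ∑ as (λ a → ⟦ P a ⟧) ≡ + length (filter (λ a → P a ≟ᵇ true) as)
∑-indicator []       P = refl
∑-indicator (a ∷ as) P with P a
... | true  = cong (_+_ 1ℤ) (∑-indicator as P)
... | false = trans (ℤ.+-identityˡ _) (∑-indicator as P)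

-- Families of partitions given by a condition on triangles

module Family {n k : ℕ} {Allow : Set} {V : Blocks (suc n) → Set} (V? : Decidable V)
  (V⇒△ : ∀ {p} → V p → Triangles Allow p)
  (△⇒V : ∀ {p} → IsPartition p → Triangles Allow p → V p) where

  family : List (Blocks (suc n))
  family = filter V? (kPartitions (suc n) k)

  family-∈⁻ : ∀ {p} → p ∈ family → IsPartition p × Triangles Allow p × length p ≡ k
  family-∈⁻ p∈ with p∈k , v ← ∈-filter⁻ V? {xs = kPartitions (suc n) k} p∈
    with p∈s , len ← ∈-filter⁻ (λ p → length p ℕ.≟ k) {xs = setPartitions (edges (suc n))} p∈k =
    p∈s , V⇒△ v , len

  family-∈⁺ : ∀ {p} → IsPartition p → Triangles Allow p → length p ≡ k → p ∈ family
  family-∈⁺ p∈ △ len = ∈-filter⁺ V? (∈-filter⁺ (λ p → length p ℕ.≟ k) p∈ len) (△⇒V p∈ △)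

  family-unique : Unique family
  family-unique = Unique.filter⁺ V? (Unique.filter⁺ (λ p → length p ℕ.≟ k)
    (setPartitions-unique (edges (suc n)) (edges-unique (suc n))))

  family-sparse : ∀ {p} → p ∈ family → Sparse (bit (Des p))
  family-sparse p∈ = triangles-sparse (proj₁ (family-∈⁻ p∈)) (proj₁ (proj₂ (family-∈⁻ p∈)))

  satisfying : List Bool → List (Blocks (suc n))
  satisfying w = filter (λ p → prescribed w [] (bit (Des p)) ≟ᵇ true) family

  module _ {m c d : Fin (suc n)} (m≢c : m ≢ c) (m≢d : m ≢ d)
           (m~c : Adjacent m c) (m~d : Adjacent m d) (w w′ : List Bool)
           (singleton : ∀ {p} → prescribed w [] (bit (Des p)) ≡ true → [ edgeOf (m , d) ] ∈ p)
           (convert : ∀ {p q} → [ edgeOf (m , c) ] ∈ q →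
             (∀ {x y} → x ≢ m → y ≢ m → x ≢ c → y ≢ c → x <ᶠ y → [ (x , y) ] ∈ p → [ (x , y) ] ∈ q) →
             prescribed w [] (bit (Des p)) ≡ true → prescribed w′ [] (bit (Des q)) ≡ true) where

    private
      module C = Collapse m≢c m≢d m~c
      module D = Collapse m≢d m≢c m~d

    -- The word `w` forces {m , d} to be a singleton, so pulling back along `C.moveEdge` is undone
    -- by pulling back along `D.moveEdge`. A second use with `c` and `d` swapped will give equality.
    exchange-≤ : length (satisfying w) ≤ length (satisfying w′)
    exchange-≤ = length-injection (pull C.moveEdge) injective (Unique.filter⁺ _ family-unique) into
      where
      member : ∀ {p} → p ∈ satisfying w → p ∈ family × prescribed w [] (bit (Des p)) ≡ true
      member = ∈-filter⁻ (λ p → prescribed w [] (bit (Des p)) ≟ᵇ true) {xs = family}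
      back : ∀ {p} → p ∈ satisfying w → pull D.moveEdge (pull C.moveEdge p) ≡ p
      back p∈ with p∈f , w-ok ← member p∈ with p∈s , △ , _ ← family-∈⁻ p∈f =
        pull-back m≢c m≢d m~c m~d p∈s △ (singleton w-ok)
      injective : ∀ {p q} → p ∈ satisfying w → q ∈ satisfying w → pull C.moveEdge p ≡ pull C.moveEdge q → p ≡ q
      injective p∈ q∈ eq = trans (sym (back p∈)) (trans (cong (pull D.moveEdge) eq) (back q∈))
      into : ∀ {p} → p ∈ satisfying w → pull C.moveEdge p ∈ satisfying w′
      into {p} p∈ with p∈f , w-ok ← member p∈ with p∈s , △ , len ← family-∈⁻ p∈f =
        ∈-filter⁺ (λ p → prescribed w′ [] (bit (Des p)) ≟ᵇ true)
          (family-∈⁺ (pull-partition C.moveEdge p) (C.pull-triangles p∈s △)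
            (trans (pull-blocks m≢c m≢d m~c m~d p∈s △ (singleton w-ok)) len))
          (convert {p} {pull C.moveEdge p} (C.pull-moved {Allow} p∈s (singleton w-ok))
            (C.pull-unmoved {Allow} p∈s) w-ok)

  module _ (u v : List Bool) (size≡ : size (u ++ true ∷ false ∷ v) ≡ suc n) where

    private
      -- The middle one of three consecutive vertices is the one that moves: it is paired with the
      -- lower vertex in `DM` and with the upper vertex in `MD`.
      DM MD : List Bool
      DM = u ++ true ∷ false ∷ v
      MD = u ++ false ∷ true ∷ v

      bound : 3 ℕ.+ size u ≤ suc n
      bound = subst (3 ℕ.+ size u ≤_) (trans (sym (size-++ u (true ∷ false ∷ v))) size≡)
        (subst (_≤ size u ℕ.+ (3 ℕ.+ size v)) (ℕ.+-comm (size u) 3) (ℕ.+-monoʳ-≤ (size u) (ℕ.m≤m+n 3 (size v))))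

      first second : Fin n
      first  = fromℕ< (ℕ.≤-trans (ℕ.n≤1+n _) (ℕ.≤-pred bound))
      second = fromℕ< (ℕ.≤-pred bound)

      toℕ-first : toℕ first ≡ size u
      toℕ-first = Fin.toℕ-fromℕ< _
      toℕ-second : toℕ second ≡ suc (size u)
      toℕ-second = Fin.toℕ-fromℕ< _

      lo mid hi : Fin (suc n)
      lo  = inject₁ first
      mid = suc first
      hi  = suc second

      toℕ-lo : toℕ lo ≡ size u
      toℕ-lo = trans (Fin.toℕ-inject₁ first) toℕ-first
      toℕ-mid : toℕ mid ≡ suc (size u)
      toℕ-mid = cong suc toℕ-first
      toℕ-hi : toℕ hi ≡ suc (suc (size u))
      toℕ-hi = cong suc toℕ-second

      inject₁-second : inject₁ second ≡ mid
      inject₁-second = Fin.toℕ-injective (trans (Fin.toℕ-inject₁ second) (trans toℕ-second (sym toℕ-mid)))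

      lo<mid : lo <ᶠ mid
      lo<mid = inject₁<suc first
      mid<hi : mid <ᶠ hi
      mid<hi = subst (_<ᶠ hi) inject₁-second (inject₁<suc second)

      mid~hi : Adjacent mid hi
      mid~hi = Adjacent-suc (trans toℕ-hi (cong suc (sym toℕ-mid)))
      mid~lo : Adjacent mid lo
      mid~lo = Adjacent-pred (trans toℕ-mid (cong suc (sym toℕ-lo)))

      descent-at : ∀ {p} (i : Fin n) {j} → toℕ i ≡ j → bit (Des p) j ≡ true → Descent p i
      descent-at {p} i i≡j eq with i′ , i′≡j , des ← Des⁻ p _ eq =
        subst (Descent p) (Fin.toℕ-injective (trans i′≡j (sym i≡j))) des

      lo-mid⁻ : ∀ {p} → bit (Des p) (size u) ≡ true → [ edgeOf (mid , lo) ] ∈ p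
      lo-mid⁻ {p} eq = subst (λ e → [ e ] ∈ p) (sym (edgeOf-> lo<mid)) (descent-at {p} first toℕ-first eq)

      mid-hi⁻ : ∀ {p} → bit (Des p) (suc (size u)) ≡ true → [ edgeOf (mid , hi) ] ∈ p
      mid-hi⁻ {p} eq = subst (λ e → [ e ] ∈ p) (trans (cong (_, hi) inject₁-second) (sym (edgeOf-< mid<hi)))
        (descent-at {p} second toℕ-second eq)

      lo-mid⁺ : ∀ {p} → [ edgeOf (mid , lo) ] ∈ p → bit (Des p) (size u) ≡ true
      lo-mid⁺ {p} ∈p = subst (λ j → bit (Des p) j ≡ true) toℕ-first
        (Des⁺ p first (subst (λ e → [ e ] ∈ p) (edgeOf-> lo<mid) ∈p))

      mid-hi⁺ : ∀ {p} → [ edgeOf (mid , hi) ] ∈ p → bit (Des p) (suc (size u)) ≡ true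
      mid-hi⁺ {p} ∈p = subst (λ j → bit (Des p) j ≡ true) toℕ-second
        (Des⁺ p second (subst (λ e → [ e ] ∈ p) (trans (edgeOf-< mid<hi) (cong (_, hi) (sym inject₁-second))) ∈p))

      outside-≢ : ∀ {j s t} → Outside s j → s ≤ t → t ≤ 2 ℕ.+ s → j ≢ t × suc j ≢ t
      outside-≢ (inj₁ lt) s≤t _ = (λ { refl → ℕ.<⇒≱ (ℕ.<-trans (ℕ.n<1+n _) lt) s≤t }) , λ { refl → ℕ.<⇒≱ lt s≤t }
      outside-≢ (inj₂ le) _ t≤  = (λ { refl → ℕ.<⇒≱ le t≤ }) , λ { refl → ℕ.<⇒≱ (ℕ.m≤n⇒m≤1+n le) t≤ }

      outside : ∀ {p q} {z : Fin (suc n)} → size u ≤ toℕ z → toℕ z ≤ 2 ℕ.+ size u →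
        (∀ {x y} → x ≢ mid → y ≢ mid → x ≢ z → y ≢ z → x <ᶠ y → [ (x , y) ] ∈ p → [ (x , y) ] ∈ q) →
        ∀ j → Outside (size u) j → bit (Des p) j ≡ true → bit (Des q) j ≡ true
      outside {p} {q} {z} ≤z z≤ keep j o eq with i , refl , des ← Des⁻ p j eq =
        Des⁺ q i (keep (proj₁ (≢mid) ) (proj₂ ≢mid) (proj₁ ≢z) (proj₂ ≢z) (inject₁<suc i) des)
        where
        away : ∀ (z : Fin (suc n)) → size u ≤ toℕ z → toℕ z ≤ 2 ℕ.+ size u → inject₁ i ≢ z × suc i ≢ z
        away z ≤z z≤ with ≢₁ , ≢₂ ← outside-≢ o ≤z z≤ =
          (λ eq → ≢₁ (trans (sym (Fin.toℕ-inject₁ i)) (cong toℕ eq))) , λ eq → ≢₂ (cong toℕ eq)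
        ≢mid : inject₁ i ≢ mid × suc i ≢ mid
        ≢mid = away mid (subst (size u ≤_) (sym toℕ-mid) (ℕ.n≤1+n _))
          (subst (_≤ 2 ℕ.+ size u) (sym toℕ-mid) (ℕ.n≤1+n _))
        ≢z : inject₁ i ≢ z × suc i ≢ z
        ≢z = away z ≤z z≤

    satisfying-exchange : length (satisfying DM) ≡ length (satisfying MD)
    satisfying-exchange = ℕ.≤-antisym
      (exchange-≤ (Fin.<⇒≢ mid<hi) (≢-sym (Fin.<⇒≢ lo<mid)) mid~hi mid~lo DM MD
        (λ {p} eq → lo-mid⁻ {p} (prescribed-here u v eq))
        λ {p} {q} mid-hi keep → prescribed-right u v (mid-hi⁺ {q} mid-hi) (outside {p} {q}
          (subst (size u ≤_) (sym toℕ-hi) (ℕ.m≤n+m _ 2)) (ℕ.≤-reflexive toℕ-hi) keep))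
      (exchange-≤ (≢-sym (Fin.<⇒≢ lo<mid)) (Fin.<⇒≢ mid<hi) mid~lo mid~hi MD DM
        (λ {p} eq → mid-hi⁻ {p} (prescribed-next u v eq))
        λ {p} {q} lo-mid keep → prescribed-left u v (lo-mid⁺ {q} lo-mid) (outside {p} {q}
          (ℕ.≤-reflexive (sym toℕ-lo)) (subst (_≤ 2 ℕ.+ size u) (sym toℕ-lo) (ℕ.m≤n+m _ 2)) keep))

    family-exchange : ∑ family (λ p → ⟦ prescribed DM [] (bit (Des p)) ⟧)
      ≡ ∑ family (λ p → ⟦ prescribed MD [] (bit (Des p)) ⟧)
    family-exchange = trans (∑-indicator family _) (trans (cong +_ satisfying-exchange) (sym (∑-indicator family _)))

  family-symmetric : IsSymmetric (𝓠 family)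
  family-symmetric = 𝓠-symmetric family family-sparse family-exchange

  family-schurPositive : SchurPositive (𝓠 family)
  family-schurPositive = 𝓠-schurPositive family family-sparse family-exchange

-- Cycles and triangles

zip-∈ : ∀ {A : Set} (as bs : List A) {s} → s ∈ zip as bs → proj₁ s ∈ as × proj₂ s ∈ bs
zip-∈ (a ∷ as) (b ∷ bs) (here refl) = here refl , here refl
zip-∈ (a ∷ as) (b ∷ bs) (there s∈) with a∈ , b∈ ← zip-∈ as bs s∈ = there a∈ , there b∈

edgeOf-swap : {a b : Fin n} → a ≢ b → edgeOf (a , b) ≡ edgeOf (b , a)
edgeOf-swap {a = a} {b} a≢b with Fin.<-cmp a b
... | tri< a<b _ _ = trans (edgeOf-< a<b) (sym (edgeOf-> a<b))
... | tri≈ _ a≡b _ = contradiction a≡b a≢b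
... | tri> _ _ b<a = trans (edgeOf-> b<a) (sym (edgeOf-< b<a))

-- Two steps of a cycle in the same block witness the defining condition of a
-- Gallai or transitive partition if they conflict.
record ConflictRelation (n : ℕ) (Allow : Set) : Set₁ where
  field
    Conflict : (s t : Fin n × Fin n) → Set
    symmetric   : ∀ {s t} → Conflict s t → Conflict t s
    irreflexive : ∀ {s} → ¬ Conflict s s
    reversal    : ∀ {a b c d} → a ≢ b → c ≢ d → Conflict (a , b) (c , d) → Conflict (b , a) (d , c)
    -- Here `x` is the vertex cut off by the chord {a , c}: `s` is a step at `x`, and `t` is a step
    -- of the rest of the cycle.
    chord       : ∀ {a c x s t} → proj₁ s ≡ x ⊎ proj₂ s ≡ x → proj₁ t ≢ x × proj₂ t ≢ x →
                  Conflict s (c , a) → Conflict (a , c) t → Conflict s t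
    -- The steps from `a` and from `b` rise and the step from `c` falls, so only the pair of rising
    -- steps depends on `Allow`.
    triangle    : ∀ {a b c} → a <ᶠ b → b <ᶠ c →
                  (Allow → Conflict (a , b) (b , c)) × Conflict (b , c) (c , a) × Conflict (c , a) (a , b)
    allowed     : ∀ {a b c} → a <ᶠ b → b <ᶠ c → Conflict (a , b) (b , c) → Allow

-- A cycle with more than three vertices v₁ v₂ v₃ … is cut by the chord v₁v₃ into
-- a triangle and a shorter cycle: a conflict of either of these that involves
-- the chord combines with the other's to a conflict of the long cycle.
module Cycles {n : ℕ} {Allow : Set} (conflict : ConflictRelation n Allow) {p : Blocks n} where

  open ConflictRelation conflict

  Clash : (s t : Fin n × Fin n) → Set
  Clash s t = Conflict s t × Together p (edgeOf s) (edgeOf t)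

  clash-sym : ∀ {s t} → Clash s t → Clash t s
  clash-sym (e , t) = symmetric e , together-sym t

  clash-swap : ∀ {a b c d} → a ≢ b → c ≢ d → Clash (a , b) (c , d) → Clash (b , a) (d , c)
  clash-swap a≢b c≢d (e , t) = reversal a≢b c≢d e , subst₂ (Together p) (edgeOf-swap a≢b) (edgeOf-swap c≢d) t

  Clashing : List (Fin n × Fin n) → Set
  Clashing ss = ∃ λ s → ∃ λ t → s ∈ ss × t ∈ ss × Clash s t

  ClashingTriple : (a b c : Fin n) → Set
  ClashingTriple a b c = Clash (a , b) (b , c) ⊎ Clash (b , c) (c , a) ⊎ Clash (c , a) (a , b)

  clashing⇒triple : ∀ {a b c} → Clashing (steps (a ∷ b ∷ c ∷ [])) → ClashingTriple a b c
  clashing⇒triple (_ , _ , here refl                 , here refl                 , e , _) = contradiction e irreflexive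
  clashing⇒triple (_ , _ , here refl                 , there (here refl)         , cl)    = inj₁ cl
  clashing⇒triple (_ , _ , here refl                 , there (there (here refl)) , cl)    = inj₂ (inj₂ (clash-sym cl))
  clashing⇒triple (_ , _ , there (here refl)         , here refl                 , cl)    = inj₁ (clash-sym cl)
  clashing⇒triple (_ , _ , there (here refl)         , there (here refl)         , e , _) = contradiction e irreflexive
  clashing⇒triple (_ , _ , there (here refl)         , there (there (here refl)) , cl)    = inj₂ (inj₁ cl)
  clashing⇒triple (_ , _ , there (there (here refl)) , here refl                 , cl)    = inj₂ (inj₂ cl)
  clashing⇒triple (_ , _ , there (there (here refl)) , there (here refl)         , cl)    = inj₂ (inj₁ (clash-sym cl))
  clashing⇒triple (_ , _ , there (there (here refl)) , there (there (here refl)) , e , _) = contradiction e irreflexive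

  clashing⇒triangles : (∀ vs → IsCycle vs → Clashing (steps vs)) → Triangles Allow p
  clashing⇒triangles cycles {a} {b} {c} a<b b<c with clashing⇒triple (cycles (a ∷ b ∷ c ∷ [])
      (s≤s (s≤s (s≤s z≤n)) , (Fin.<⇒≢ a<b ∷ Fin.<⇒≢ (Fin.<-trans a<b b<c) ∷ []) ∷ (Fin.<⇒≢ b<c ∷ []) ∷ [] ∷ []))
  ... | inj₁ (e , t)        = inj₁ (allowed a<b b<c e , subst₂ (Together p) (edgeOf-< a<b) (edgeOf-< b<c) t)
  ... | inj₂ (inj₁ (_ , t)) = inj₂ (inj₂ (subst₂ (Together p) (edgeOf-< b<c) (edgeOf-> (Fin.<-trans a<b b<c)) t))
  ... | inj₂ (inj₂ (_ , t)) = inj₂ (inj₁ (together-sym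
    (subst₂ (Together p) (edgeOf-> (Fin.<-trans a<b b<c)) (edgeOf-< a<b) t)))

  module _ (p∈ : IsPartition p) (△ : Triangles Allow p) where

    triple-< : ∀ {a b c} → a <ᶠ b → b <ᶠ c → ClashingTriple a b c
    triple-< a<b b<c with △ a<b b<c | triangle a<b b<c
    ... | inj₁ (allow , t) | ab-bc , _ , _ = inj₁ (ab-bc allow ,
      subst₂ (Together p) (sym (edgeOf-< a<b)) (sym (edgeOf-< b<c)) t)
    ... | inj₂ (inj₁ t) | _ , _ , ca-ab = inj₂ (inj₂ (ca-ab ,
      subst₂ (Together p) (sym (edgeOf-> (Fin.<-trans a<b b<c))) (sym (edgeOf-< a<b)) (together-sym t)))
    ... | inj₂ (inj₂ t) | _ , bc-ca , _ = inj₂ (inj₁ (bc-ca ,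
      subst₂ (Together p) (sym (edgeOf-< b<c)) (sym (edgeOf-> (Fin.<-trans a<b b<c))) t))

    rotate : ∀ {a b c} → ClashingTriple a b c → ClashingTriple b c a
    rotate (inj₁ x)        = inj₂ (inj₂ x)
    rotate (inj₂ (inj₁ x)) = inj₁ x
    rotate (inj₂ (inj₂ x)) = inj₂ (inj₁ x)

    reflect : ∀ {a b c} → a ≢ b → b ≢ c → c ≢ a → ClashingTriple a b c → ClashingTriple c b a
    reflect a≢b b≢c c≢a (inj₁ x)        = inj₁ (clash-sym (clash-swap a≢b b≢c x))
    reflect a≢b b≢c c≢a (inj₂ (inj₁ x)) = inj₂ (inj₂ (clash-sym (clash-swap b≢c c≢a x)))
    reflect a≢b b≢c c≢a (inj₂ (inj₂ x)) = inj₂ (inj₁ (clash-sym (clash-swap c≢a a≢b x)))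

    -- Rotating and reversing the traversal brings the three vertices into increasing order.
    triple : ∀ {a b c} → a ≢ b → b ≢ c → c ≢ a → ClashingTriple a b c
    triple {a} {b} {c} a≢b b≢c c≢a with Fin.<-cmp a b | Fin.<-cmp b c | Fin.<-cmp c a
    ... | tri≈ _ a≡b _ | _ | _ = contradiction a≡b a≢b
    ... | _ | tri≈ _ b≡c _ | _ = contradiction b≡c b≢c
    ... | _ | _ | tri≈ _ c≡a _ = contradiction c≡a c≢a
    ... | tri< a<b _ _ | tri< b<c _ _ | _            = triple-< a<b b<c
    ... | tri< a<b _ _ | tri> _ _ c<b | tri< c<a _ _ = rotate (triple-< c<a a<b)
    ... | tri< a<b _ _ | tri> _ _ c<b | tri> _ _ a<c = 
      rotate (rotate (reflect (≢-sym c≢a) (≢-sym b≢c) (≢-sym a≢b) (triple-< a<c c<b)))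
    ... | tri> _ _ b<a | tri< b<c _ _ | tri< c<a _ _ = rotate (rotate (triple-< b<c c<a))
    ... | tri> _ _ b<a | tri< b<c _ _ | tri> _ _ a<c = 
      rotate (reflect (≢-sym a≢b) (≢-sym c≢a) (≢-sym b≢c) (triple-< b<a a<c))
    ... | tri> _ _ b<a | tri> _ _ c<b | _            = reflect (≢-sym b≢c) (≢-sym a≢b) (≢-sym c≢a) (triple-< c<b b<a)

    triple⇒clashing : ∀ {a b c} → ClashingTriple a b c → Clashing (steps (a ∷ b ∷ c ∷ []))
    triple⇒clashing (inj₁ cl)        = _ , _ , here refl , there (here refl) , cl
    triple⇒clashing (inj₂ (inj₁ cl)) = _ , _ , there (here refl) , there (there (here refl)) , cl
    triple⇒clashing (inj₂ (inj₂ cl)) = _ , _ , there (there (here refl)) , here refl , cl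

    combine : ∀ {a c x s t} → a ≢ c → proj₁ s ≡ x ⊎ proj₂ s ≡ x → proj₁ t ≢ x × proj₂ t ≢ x →
      Clash s (c , a) → Clash (a , c) t → Clash s t
    combine a≢c x∈s x∉t (e , u) (e′ , u′) = chord x∈s x∉t e e′ ,
      together-trans (IsPartition-disjoint p∈) (subst (Together p _) (edgeOf-swap (≢-sym a≢c)) u) u′

    module _ {a b c d : Fin n} {vs : List (Fin n)} (abc! : Unique (a ∷ b ∷ c ∷ d ∷ vs)) where

      private
        a≢b : a ≢ b
        a≢b = case abc! of λ { ((neq ∷ _) ∷ _) → neq }
        a≢c : a ≢ c
        a≢c = case abc! of λ { ((_ ∷ neq ∷ _) ∷ _) → neq }
        b∉ : All (b ≢_) (c ∷ d ∷ vs)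
        b∉ = case abc! of λ { (_ ∷ b∉ ∷ _) → b∉ }

        rest : List (Fin n × Fin n)
        rest = zip (c ∷ d ∷ vs) (d ∷ vs ∷ʳ a)

        avoids : ∀ {t} → t ∈ rest → proj₁ t ≢ b × proj₂ t ≢ b
        avoids t∈ with ∈₁ , ∈₂ ← zip-∈ (c ∷ d ∷ vs) (d ∷ vs ∷ʳ a) t∈ =
          (λ eq → All.lookup b∉ ∈₁ (sym eq)) ,
          λ eq → case ∈-++⁻ (d ∷ vs) ∈₂ of λ
            { (inj₁ x∈)         → All.lookup (All.tail b∉) x∈ (sym eq)
            ; (inj₂ (here x≡a)) → a≢b (trans (sym x≡a) eq) }

      replace-chord : Clash (b , c) (c , a) ⊎ Clash (c , a) (a , b) →
        ∀ {t} → t ∈ rest → Clash (a , c) t → Clashing (steps (a ∷ b ∷ c ∷ d ∷ vs))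
      replace-chord (inj₁ cl) t∈ cl′ =
        _ , _ , there (here refl) , there (there t∈) , combine a≢c (inj₁ refl) (avoids t∈) cl cl′
      replace-chord (inj₂ cl) t∈ cl′ =
        _ , _ , here refl , there (there t∈) , combine a≢c (inj₂ refl) (avoids t∈) (clash-sym cl) cl′

    long-cycle : ∀ a b c vs → Unique (a ∷ b ∷ c ∷ vs) → Clashing (steps (a ∷ b ∷ c ∷ vs))
    long-cycle a b c []       ((a≢b ∷ a≢c ∷ []) ∷ (b≢c ∷ []) ∷ _) = triple⇒clashing (triple a≢b b≢c (≢-sym a≢c))
    long-cycle a b c (d ∷ vs) abc!@((a≢b ∷ a≢c ∷ a∉) ∷ (b≢c ∷ b∉) ∷ c!)
      with long-cycle a c d vs ((a≢c ∷ a∉) ∷ c!) | triple a≢b b≢c (≢-sym a≢c)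
    -- A clash without the chord, in the triangle or in the shorter cycle, is already a clash of the
    -- long cycle.
    ... | _                                     | inj₁ cl    = _ , _ , here refl , there (here refl) , cl
    ... | _ , _ , there s∈  , there t∈  , cl    | inj₂ _     = _ , _ , there (there s∈) , there (there t∈) , cl
    ... | _ , _ , here refl , here refl , e , _ | inj₂ _     = contradiction e irreflexive
    -- Both clashes involve the chord, which the triangle and the shorter cycle traverse in opposite
    -- directions.
    ... | _ , _ , here refl , there t∈  , cl    | inj₂ tri   = replace-chord abc! tri t∈ cl
    ... | _ , _ , there s∈  , here refl , cl    | inj₂ tri   = replace-chord abc! tri s∈ (clash-sym cl)

    triangles⇒clashing : ∀ vs → IsCycle vs → Clashing (steps vs)
    triangles⇒clashing (a ∷ b ∷ c ∷ vs) (_ , vs!) = long-cycle a b c vs vs!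
    triangles⇒clashing (a ∷ b ∷ [])     (s≤s (s≤s ()) , _)
    triangles⇒clashing (a ∷ [])         (s≤s () , _)

-- The Gallai and the transitive condition as conflict relations

module _ {n : ℕ} where

  private
    -- `Opposite` admits both orders of the pair to be symmetric, whereas `IsTransitive` names the
    -- forward step first.
    Distinct Opposite : (s t : Fin n × Fin n) → Set
    Distinct s t = edgeOf s ≢ edgeOf t
    Opposite s t = (proj₁ s <ᶠ proj₂ s × proj₂ t <ᶠ proj₁ t) ⊎ (proj₂ s <ᶠ proj₁ s × proj₁ t <ᶠ proj₂ t)

    edgeOf-meets : ∀ (s t : Fin n × Fin n) {x} → edgeOf s ≡ edgeOf t →
      proj₁ s ≡ x ⊎ proj₂ s ≡ x → proj₁ t ≡ x ⊎ proj₂ t ≡ x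
    edgeOf-meets (a , b) (c , d) eq x∈s with a <?ᶠ b
    edgeOf-meets (a , b) (c , d) eq x∈s         | yes _ with edgeOf-inverse c d eq
    edgeOf-meets (a , b) (c , d) eq x∈s         | yes _ | inj₁ (refl , refl) = x∈s
    edgeOf-meets (a , b) (c , d) eq (inj₁ refl) | yes _ | inj₂ (refl , refl) = inj₂ refl
    edgeOf-meets (a , b) (c , d) eq (inj₂ refl) | yes _ | inj₂ (refl , refl) = inj₁ refl
    edgeOf-meets (a , b) (c , d) eq x∈s         | no _  with edgeOf-inverse c d eq
    edgeOf-meets (a , b) (c , d) eq (inj₁ refl) | no _  | inj₁ (refl , refl) = inj₂ refl
    edgeOf-meets (a , b) (c , d) eq (inj₂ refl) | no _  | inj₁ (refl , refl) = inj₁ refl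
    edgeOf-meets (a , b) (c , d) eq x∈s         | no _  | inj₂ (refl , refl) = x∈s

    avoid : ∀ {t : Fin n × Fin n} {x} → proj₁ t ≢ x × proj₂ t ≢ x → ¬ (proj₁ t ≡ x ⊎ proj₂ t ≡ x)
    avoid (≢₁ , _) (inj₁ eq) = ≢₁ eq
    avoid (_ , ≢₂) (inj₂ eq) = ≢₂ eq

    distinct : ConflictRelation n ⊤
    distinct = record
      { Conflict    = Distinct
      ; symmetric   = ≢-sym
      ; irreflexive = λ neq → neq refl
      ; reversal    = λ a≢b c≢d neq eq → neq (trans (edgeOf-swap a≢b) (trans eq (sym (edgeOf-swap c≢d))))
      ; chord       = λ {s = s} {t} x∈s x∉t _ _ eq → avoid x∉t (edgeOf-meets s t eq x∈s)
      ; triangle    = λ {a} {b} {c} a<b b<c → let a<c = Fin.<-trans a<b b<c in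
          (λ _ eq → avoid (≢-sym (Fin.<⇒≢ a<b) , ≢-sym (Fin.<⇒≢ a<c)) (edgeOf-meets (a , b) (b , c) eq (inj₁ refl))) ,
          (λ eq → avoid (≢-sym (Fin.<⇒≢ b<c) , Fin.<⇒≢ a<b) (edgeOf-meets (b , c) (c , a) eq (inj₁ refl))) ,
          (λ eq → avoid (Fin.<⇒≢ a<c , Fin.<⇒≢ b<c) (edgeOf-meets (c , a) (a , b) eq (inj₁ refl)))
      ; allowed     = λ _ _ _ → tt
      }

    opposite : ConflictRelation n ⊥
    opposite = record
      { Conflict    = Opposite
      ; symmetric   = λ { (inj₁ (s , t)) → inj₂ (t , s) ; (inj₂ (s , t)) → inj₁ (t , s) }
      ; irreflexive = λ { (inj₁ (lt , gt)) → Fin.<-asym lt gt ; (inj₂ (gt , lt)) → Fin.<-asym lt gt }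
      ; reversal    = λ { _ _ (inj₁ st) → inj₂ st ; _ _ (inj₂ st) → inj₁ st }
      -- The chord rises in one direction and falls in the other, so steps opposed to its two
      -- directions are opposed to each other.
      ; chord       = λ
          { _ _ (inj₁ (s , _)) (inj₁ (_ , t)) → inj₁ (s , t)
          ; _ _ (inj₂ (s , _)) (inj₂ (_ , t)) → inj₂ (s , t)
          ; _ _ (inj₁ (_ , a<c)) (inj₂ (c<a , _)) → contradiction a<c (Fin.<-asym c<a)
          ; _ _ (inj₂ (_ , c<a)) (inj₁ (a<c , _)) → contradiction a<c (Fin.<-asym c<a) }
      ; triangle    = λ a<b b<c → (λ ()) , inj₁ (b<c , Fin.<-trans a<b b<c) , inj₂ (Fin.<-trans a<b b<c , a<b)
      ; allowed     = λ
          { a<b b<c (inj₁ (_ , c<b)) → Fin.<-asym b<c c<b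
          ; a<b b<c (inj₂ (b<a , _)) → Fin.<-asym a<b b<a }
      }

    module Gallai {p : Blocks n} = Cycles distinct {p}
    module Transitive {p : Blocks n} = Cycles opposite {p}

  gallai⇒triangles : ∀ {p : Blocks n} → IsGallai p → Triangles ⊤ p
  gallai⇒triangles gallai = Gallai.clashing⇒triangles λ vs cyc → case find (gallai vs cyc) of λ
    { (s , s∈ , any) → case find any of λ { (t , t∈ , neq , tog) → s , t , s∈ , t∈ , neq , tog } }

  triangles⇒gallai : ∀ {p : Blocks n} → IsPartition p → Triangles ⊤ p → IsGallai p
  triangles⇒gallai p∈ △ vs cyc with s , t , s∈ , t∈ , neq , tog ← Gallai.triangles⇒clashing p∈ △ vs cyc =
    lose s∈ (lose t∈ (neq , tog))

  transitive⇒triangles : ∀ {p : Blocks n} → IsTransitive p → Triangles ⊥ p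
  transitive⇒triangles transitive = Transitive.clashing⇒triangles λ vs cyc → case find (transitive vs cyc) of λ
    { (s , s∈ , any) → case find any of λ { (t , t∈ , fwd , bwd , tog) → s , t , s∈ , t∈ , inj₁ (fwd , bwd) , tog } }

  triangles⇒transitive : ∀ {p : Blocks n} → IsPartition p → Triangles ⊥ p → IsTransitive p
  triangles⇒transitive p∈ △ vs cyc with Transitive.triangles⇒clashing p∈ △ vs cyc
  ... | s , t , s∈ , t∈ , inj₁ (fwd , bwd) , tog = lose s∈ (lose t∈ (fwd , bwd , tog))
  ... | s , t , s∈ , t∈ , inj₂ (bwd , fwd) , tog = lose t∈ (lose s∈ (fwd , bwd , together-sym tog))

theorem1p23 : (n k : ℕ) → 1 ≤ k → k < n →
    (IsSymmetric (𝓠 (G n k)) × SchurPositive (𝓠 (G n k))) ×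
    (IsSymmetric (𝓠 (T n k)) × SchurPositive (𝓠 (T n k)))
theorem1p23 (suc n) k _ _ = (Gallai.family-symmetric , Gallai.family-schurPositive) ,
                            (Transitive.family-symmetric , Transitive.family-schurPositive)
  where
  module Gallai     = Family {n} {k} isGallai? gallai⇒triangles triangles⇒gallai
  module Transitive = Family {n} {k} isTransitive? transitive⇒triangles triangles⇒transitive
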